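{- For $0<\varepsilon<\frac{1}{121}$, Algorithm Enhanced-ED-Approx (run on $S,S',N_1,N_2,\mathrm{Dec}_{\mathcal C_1},\mathrm{Dec}_{\mathcal C_2}$) computes a set of up to $(1+23\varepsilon)\cdot\mathrm{ED}(S,S')$ insertions and deletions that turn $S$ into $S'$.
   Context: $\mathrm{ED}(A,B)$ is the minimum number of single-character insertions and deletions (no substitutions) needed to transform $A$ into $B$. Setting. For $t=1,2$, $\mathcal C_t$ is an insertion-deletion code of block length $N_t$ and rate $r_t$ over alphabet $\Sigma_{\mathcal C_t}$ that is $L_t$-list decodable from $N_t(1-\varepsilon)$ insertions and $N_t(1-\varepsilon)$ deletions: for a string $y$, the decoder output $\mathrm{Dec}_{\mathcal C_t}(y)$ is the set (of size at most $L_t$) of all indices $j$ such that the $j$-th codeword of $\mathcal C_t$ can be turned into $y$ by $N_t(1-\varepsilon)$ deletions and $N_t(1-\varepsilon)$ insertions. Let $I'$ be the concatenation of all codewords of $\mathcal C_2$, of length $|I'|=N_2|\Sigma_{\mathcal C_2}|^{N_2r_2}$; the block length of $\mathcal C_1$ is $N_1=|I'|$. Let $I_1$ be the concatenation of all codewords of $\mathcal C_1$, $I_2$ the string $I'$ repeated $|\mathcal C_1|$ times, and $I$ the string with $i$-th symbol $((I_1)_i,(I_2)_i)$. $S$ is the string with $i$-th symbol $(m_i,I_i)$ for an arbitrary content string $m$ with $|m|=|I|$; $S'$ is a given string over the same product alphabet. $S$ and $S'$ are split into consecutive blocks $S(i),S'(i)$ of length $N_1$, and each block is split into consecutive sub-blocks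 of length $N_2$: $S(k,k')$ denotes the $k'$-th sub-block of $S(k)$ and $S'(i,i')$ the $i'$-th sub-block of $S'(i)$. $C'_i$ is the $\mathcal C_1$-index component of $S'(i)$, and $C''_{i,i'}$ is the $\mathcal C_2$-index component of $S'(i,i')$. Algorithm Enhanced-ED-Approx. Let $w=1/\varepsilon$. Start with an empty bipartite graph $G$ with parts of size $|S|$ and $|S'|$, whose vertices are the positions of $S$ and of $S'$. For each block $S'(i)$: set $List_1\leftarrow\mathrm{Dec}_{\mathcal C_1}(C'_i)$; for each $j\in List_1$, for each $k\in[j-w,j+w]$, for each $i'\in[1,N_1/N_2]$: set $List_2\leftarrow\mathrm{Dec}_{\mathcal C_2}(C''_{i,i'})$; for each $j'\in List_2$ and each $k'\in[j'-w,j'+w]$, connect any pair of vertices of $G$ that correspond to identical symbols in $S(k,k')$ and $S'(i,i')$. Finally return a largest non-crossing matching of $G$ (a set of edges $(u_{i_1},v_{j_1}),\dots,(u_{i_t},v_{j_t})$ with $i_1<\dots<i_t$, $j_1<\dots<j_t$). The returned matching is identified with the set of operations that deletes every unmatched symbol of $S$ and inserts every unmatched symbol of $S'$.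
   Formalization: For k′ outside [1,N₁/N₂], where S(k,k′) is undefined, it is read as the length-N₂ piece of S continuing into neighbouring blocks (skipping such k′ makes the bound false); and |S′| is taken to be a multiple of N₁, since a short last block also breaks the bound. -}

module Defs where

open import Algebra.Bundles using (CommutativeRing)
import Algebra.Definitions.RawMonoid as RawMonoidMult
open import Data.Fin as Fin using (Fin; toℕ; combine)
import Data.Fin.Properties as Finₚ
open import Data.Integer as ℤ using (ℤ; +_; -[1+_])
open import Data.List as List using (List; []; _∷_; _++_; length; filter; allFin; reverse)
open import Data.List.Membership.Propositional using (_∈_)
import Data.List.Membership.DecPropositional as DecMembership
open import Data.List.Relation.Unary.All using (All)
open import Data.List.Relation.Unary.AllPairs using (AllPairs)
open import Data.List.Relation.Unary.Unique.Propositional using (Unique)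
open import Data.Nat as ℕ using (ℕ)
open import Data.Product using (∃-syntax; _×_; _,_; proj₁; proj₂; uncurry)
open import Data.Vec as Vec using (Vec; lookup; tabulate; concat; toList)
open import Function.Bundles using (_⇔_)
open import Function.Definitions using (Injective)
open import Level using (Level; _⊔_)
open import Relation.Binary.PropositionalEquality using (_≡_)
open import Relation.Binary.Structures using (IsDecTotalOrder)
open import Relation.Nullary using (¬_)
open import Relation.Nullary.Decidable using (¬?)

-- The parameter ε lives in an arbitrary ordered field; the real numbers (with
-- classical logic, which decides their order) and ℚ are instances.

record OrderedField (c ℓ₁ ℓ₂ : Level) : Set (Level.suc (c ⊔ ℓ₁ ⊔ ℓ₂)) where
  infix 4 _≤_ _<_
  infix 8 _⁻¹
  field
    commutativeRing : CommutativeRing c ℓ₁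

  open CommutativeRing commutativeRing public

  field
    _≤_             : Carrier → Carrier → Set ℓ₂
    isDecTotalOrder : IsDecTotalOrder _≈_ _≤_
    +-monoˡ-≤       : ∀ z {x y} → x ≤ y → x + z ≤ y + z
    *-nonNegative   : ∀ {x y} → 0# ≤ x → 0# ≤ y → 0# ≤ x * y
    0#≉1#           : ¬ (0# ≈ 1#)
    -- Only constrained at nonzero arguments.
    _⁻¹             : Carrier → Carrier
    *-inverseʳ      : ∀ {x} → ¬ (x ≈ 0#) → x * x ⁻¹ ≈ 1#

  _<_ : Carrier → Carrier → Set (ℓ₁ ⊔ ℓ₂)
  x < y = x ≤ y × ¬ (x ≈ y)

  open RawMonoidMult +-rawMonoid using () renaming (_×_ to _·_)

  fromℕ : ℕ → Carrier
  fromℕ n = n · 1#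

  fromℤ : ℤ → Carrier
  fromℤ (+ n)    = fromℕ n
  fromℤ -[1+ n ] = - fromℕ (ℕ.suc n)

------------------------------------------------------------------------
-- Insertions and deletions

data Op {a} (A : Set a) : Set a where
  delete : ℕ → Op A
  insert : ℕ → A → Op A

module _ {a} {A : Set a} where

  infix 4 _─⟨_⟩→_ _═⟨_⟩⇒_

  -- Positions refer to the string at the moment the operation is applied; an
  -- inserted symbol ends up at the stated position.
  data _─⟨_⟩→_ : List A → Op A → List A → Set a where
    delete : ∀ us x vs → us ++ x ∷ vs ─⟨ delete (length us) ⟩→ us ++ vs
    insert : ∀ us x vs → us ++ vs ─⟨ insert (length us) x ⟩→ us ++ x ∷ vs

  data _═⟨_⟩⇒_ : List A → List (Op A) → List A → Set a where
    []  : ∀ {xs} → xs ═⟨ [] ⟩⇒ xs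
    _∷_ : ∀ {xs ys zs o os} → xs ─⟨ o ⟩→ ys → ys ═⟨ os ⟩⇒ zs → xs ═⟨ o ∷ os ⟩⇒ zs

  #deletions : List (Op A) → ℕ
  #deletions []                = 0
  #deletions (delete _ ∷ os)   = ℕ.suc (#deletions os)
  #deletions (insert _ _ ∷ os) = #deletions os

  #insertions : List (Op A) → ℕ
  #insertions []                = 0
  #insertions (delete _ ∷ os)   = #insertions os
  #insertions (insert _ _ ∷ os) = ℕ.suc (#insertions os)

  -- ED xs ys d : the edit distance of xs and ys equals d.
  record ED (xs ys : List A) (d : ℕ) : Set a where
    field
      attained : ∃[ os ] (xs ═⟨ os ⟩⇒ ys × length os ≡ d)
      minimal  : ∀ os → xs ═⟨ os ⟩⇒ ys → d ℕ.≤ length os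

------------------------------------------------------------------------
-- Codes

-- A code of block length N over Fin q. Its rate is whatever r satisfies
-- size ≡ q ^ (N r), so it is not recorded separately.
record Code (q N : ℕ) : Set where
  field
    size      : ℕ
    codeword  : Fin size → Vec (Fin q) N
    injective : Injective _≡_ _≡_ codeword

open Code public

allCodewords : ∀ {q N} (C : Code q N) → Vec (Fin q) (size C ℕ.* N)
allCodewords C = concat (tabulate (codeword C))

module _ {c ℓ₁ ℓ₂} (F : OrderedField c ℓ₁ ℓ₂) where
  open OrderedField F

  -- "N(1-ε) operations" means at most that many, as N(1-ε) need not be integral.
  Corrupts : (ε : Carrier) (N : ℕ) {q : ℕ} (x y : List (Fin q)) → Set ℓ₂
  Corrupts ε N x y = ∃[ os ] (x ═⟨ os ⟩⇒ y
                              × fromℕ (#deletions os)  ≤ fromℕ N * (1# - ε)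
                              × fromℕ (#insertions os) ≤ fromℕ N * (1# - ε))

  record ListDecoder (ε : Carrier) {q N : ℕ} (C : Code q N) (L : ℕ) : Set ℓ₂ where
    field
      Dec      : List (Fin q) → List (Fin (size C))
      unique   : ∀ y → Unique (Dec y)
      size≤L   : ∀ y → length (Dec y) ℕ.≤ L
      correct  : ∀ y j → j ∈ Dec y ⇔ Corrupts ε N (toList (codeword C j)) y

------------------------------------------------------------------------
-- Non-crossing matchings

module _ {m n : ℕ} where

  Precedes : (e f : Fin m × Fin n) → Set
  Precedes (p , q) (p′ , q′) = p Fin.< p′ × q Fin.< q′

  -- The edges are listed from left to right.
  NonCrossingMatching : ∀ {g} → (Fin m → Fin n → Set g) → List (Fin m × Fin n) → Set g
  NonCrossingMatching G M = All (uncurry G) M × AllPairs Precedes M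

  LargestNonCrossingMatching : ∀ {g} → (Fin m → Fin n → Set g) → List (Fin m × Fin n) → Set g
  LargestNonCrossingMatching G M =
    NonCrossingMatching G M × (∀ M′ → NonCrossingMatching G M′ → length M′ ℕ.≤ length M)

unmatched : ∀ {n} → List (Fin n) → List (Fin n)
unmatched {n} ps = filter (λ p → ¬? (p ∈? ps)) (allFin n)
  where open DecMembership (Finₚ._≟_ {n}) using (_∈?_)

-- Deletions go from right to left and insertions from left to right, so the
-- positions of X, respectively Y, are the correct ones at the time of use.
operations : ∀ {a} {A : Set a} {m n} → Vec A m → Vec A n → List (Fin m × Fin n) → List (Op A)
operations X Y M =
     List.map (λ p → delete (toℕ p)) (reverse (unmatched (List.map proj₁ M)))
  ++ List.map (λ q → insert (toℕ q) (lookup Y q)) (unmatched (List.map proj₂ M))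

------------------------------------------------------------------------
-- The indexed string and the algorithm

-- N₁ is the length of I′, the concatenation of all codewords of 𝒞₂.
N₁ : ∀ {q₂ N₂} → Code q₂ N₂ → ℕ
N₁ {N₂ = N₂} C₂ = size C₂ ℕ.* N₂

module _ {q₁ q₂ N₂ : ℕ} (C₂ : Code q₂ N₂) (C₁ : Code q₁ (N₁ C₂)) where

  |I| : ℕ
  |I| = size C₁ ℕ.* N₁ C₂

  I₁ : Vec (Fin q₁) |I|
  I₁ = allCodewords C₁

  I₂ : Vec (Fin q₂) |I|
  I₂ = concat (Vec.replicate (size C₁) (allCodewords C₂))

  I : Vec (Fin q₁ × Fin q₂) |I|
  I = Vec.zip I₁ I₂

  indexed : ∀ {a} {Γ : Set a} → Vec Γ |I| → Vec (Γ × Fin q₁ × Fin q₂) |I|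
  indexed m = Vec.zip m I

-- All blocks, sub-blocks and codewords are numbered from 0.
module Enhanced-ED-Approx
  {c ℓ₁ ℓ₂} (F : OrderedField c ℓ₁ ℓ₂) (ε : OrderedField.Carrier F)
  {q₁ q₂ N₂ L₁ L₂ : ℕ} {C₂ : Code q₂ N₂} {C₁ : Code q₁ (N₁ C₂)}
  (D₁ : ListDecoder F ε C₁ L₁) (D₂ : ListDecoder F ε C₂ L₂)
  {a} {Γ : Set a} {b : ℕ}
  (S  : Vec (Γ × Fin q₁ × Fin q₂) (|I| C₂ C₁))
  (S′ : Vec (Γ × Fin q₁ × Fin q₂) (b ℕ.* N₁ C₂))
  where

  open OrderedField F

  w : Carrier
  w = ε ⁻¹

  _∈[_±w] : ℤ → ℤ → Set ℓ₂
  k ∈[ j ±w] = fromℤ j - w ≤ fromℤ k × fromℤ k ≤ fromℤ j + w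

  C′ : Fin b → Vec (Fin q₁) (N₁ C₂)
  C′ i = tabulate λ r → proj₁ (proj₂ (lookup S′ (combine i r)))

  -- There are N₁/N₂ = size C₂ sub-blocks in a block.
  C″ : Fin b → Fin (size C₂) → Vec (Fin q₂) N₂
  C″ i i′ = tabulate λ r → proj₂ (proj₂ (lookup S′ (combine i (combine i′ r))))

  -- Position p of S lies in S(k,k′), the string of N₂ symbols starting
  -- k N₁ + k′ N₂ symbols into S. The loop over k′ runs past the ends of S(k)
  -- when j′ is near 0 or size C₂; S(k,-1) is then the sub-block of S just
  -- before S(k,0), and so on. Skipping such k′ instead would make the
  -- approximation guarantee false, since sub-blocks of S′ may straddle the
  -- boundary of two blocks of S.
  _∈S[_,_] : Fin (|I| C₂ C₁) → Fin (size C₁) → ℤ → Set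
  p ∈S[ k , k′ ] = ∃[ r ] (+ toℕ p ≡ + (toℕ k ℕ.* N₁ C₂) ℤ.+ k′ ℤ.* + N₂ ℤ.+ + toℕ {N₂} r)

  _∈S′[_,_] : Fin (b ℕ.* N₁ C₂) → Fin b → Fin (size C₂) → Set
  q ∈S′[ i , i′ ] = ∃[ r ] (q ≡ combine i (combine {size C₂} {N₂} i′ r))

  -- The edges of G, one field per loop variable of the algorithm.
  record G (p : Fin (|I| C₂ C₁)) (q : Fin (b ℕ.* N₁ C₂)) : Set (a ⊔ ℓ₂) where
    field
      i       : Fin b
      j       : Fin (size C₁)
      j∈List₁ : j ∈ ListDecoder.Dec D₁ (toList (C′ i))
      k       : Fin (size C₁)
      k∈      : (+ toℕ k) ∈[ + toℕ j ±w]
      i′      : Fin (size C₂)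
      j′      : Fin (size C₂)
      j′∈List₂ : j′ ∈ ListDecoder.Dec D₂ (toList (C″ i i′))
      k′      : ℤ
      k′∈     : k′ ∈[ + toℕ j′ ±w]
      p∈      : p ∈S[ k , k′ ]
      q∈      : q ∈S′[ i , i′ ]
      same    : lookup S p ≡ lookup S′ q

  Returns : List (Fin (|I| C₂ C₁) × Fin (b ℕ.* N₁ C₂)) → Set (a ⊔ ℓ₂)
  Returns = LargestNonCrossingMatching G

{-# OPTIONS --safe #-}
module Submission where

-- Fix a matching M* of S and S′ realising the edit distance d, and let cost i be
-- the number of unmatched symbols in block S′(i) and in the part of S aligned with
-- it, so that the costs sum up to at most d. Suppose the edges into S′(i) touch t
-- consecutive blocks of S. If t > w, or if every block of S has fewer than an
-- ε-fraction of its symbols matched into S′(i), then the number of edges into S′(i)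
-- is at most 3ε cost i. Otherwise some block j shares an ε-fraction with S′(i), so
-- the decoder lists j, and all blocks touched lie within w of j. The same dichotomy
-- applies to the sub-blocks, numbered throughout S. Hence dropping from M* the edges
-- in bad blocks and in bad sub-blocks loses at most 6εd edges and leaves a matching
-- of G; each lost edge costs one deletion and one insertion, and 2 · 6 ≤ 23.

open import Defs
open import Algebra.Bundles using (CommutativeMonoid)
import Algebra.Properties.CommutativeSemigroup as CommutativeSemigroupProperties
import Algebra.Properties.Group as GroupProperties
import Algebra.Properties.Ring as RingProperties
import Algebra.Properties.Semiring.Mult as SemiringMult
open import Data.Fin as Fin using (Fin; zero; suc; toℕ; combine; remQuot)
import Data.Fin.Properties as Finₚ
open import Data.Integer as ℤ using (ℤ; +_; _⊖_)
import Data.Integer.Properties as ℤₚ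
import Data.Integer.Tactic.RingSolver as ℤ-RingSolver
open import Data.List as List using (List; []; _∷_; _++_; length; filter; allFin; reverse)
import Data.List.Extrema.Nat as Extrema
import Data.List.Membership.DecPropositional as DecMembership
open import Data.List.Membership.Propositional using (_∈_)
import Data.List.Membership.Propositional.Properties as ∈ₚ
import Data.List.Properties as Listₚ
open import Data.List.Relation.Unary.All as All using (All; []; _∷_)
import Data.List.Relation.Unary.All.Properties as Allₚ
open import Data.List.Relation.Unary.AllPairs as AllPairs using (AllPairs; []; _∷_)
import Data.List.Relation.Unary.AllPairs.Properties as AllPairsₚ
open import Data.List.Relation.Unary.Any using (here; there)
open import Data.Nat as ℕ using (ℕ; zero; suc; z≤n; s≤s)
import Data.Nat.Properties as ℕₚ
open import Data.Nat.Tactic.RingSolver using (solve-∀)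
open import Data.Product as Product using (∃; ∃-syntax; _×_; _,_; proj₁; proj₂; uncurry)
import Data.Product.Properties as Productₚ
open import Data.Sum as Sum using (_⊎_; inj₁; inj₂)
open import Data.Vec as Vec using (Vec; []; _∷_; lookup; toList)
import Data.Vec.Properties as Vecₚ
open import Function using (_∘_; id; _on_; Equivalence)
open import Relation.Binary.Bundles using (Preorder)
open import Relation.Binary.Core using (Rel)
open import Relation.Binary.Definitions using (DecidableEquality)
open import Relation.Binary.PropositionalEquality as ≡ using (_≡_)
import Relation.Binary.Reasoning.Preorder as PreorderReasoning
open import Relation.Binary.Structures using (IsDecTotalOrder)
open import Relation.Nullary using (¬_; Dec; yes; no; contradiction)
open import Relation.Nullary.Decidable using (¬?; map′; _×-dec_)
open import Relation.Unary using (Pred; Decidable)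

-- Ordered fields

-- What makes a thinly spread block expensive is geometry: S is cut into consecutive parts, one for
-- each block of S′, and all but the two outermost blocks of S that a block of S′ touches lie inside
-- its part. Touching many blocks, or few symbols in each, therefore leaves many symbols of that
-- part or of the block of S′ unmatched. The constant 3 absorbs the two outermost blocks and the
-- matched symbols themselves; the smallness of ε is what makes the latter negligible.
--
-- The obstacle is that the two levels need not fit together: the edges into one sub-block of S′ may
-- cross a boundary between blocks of S. The sub-block level therefore ignores the blocks of S, and
-- both levels are judged in the same matching M*. They meet only when an edge of `G` is assembled.
-- The witness of a good sub-block has its target in the same block of S′ as the edge, so the block
-- of S that contains the witness is within w of the listed j.

module OrderedFieldProperties {c ℓ₁ ℓ₂} (F : OrderedField c ℓ₁ ℓ₂) where
  open OrderedField F
  private module O = IsDecTotalOrder isDecTotalOrder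
  open SemiringMult semiring using (×-homo-+; ×1-homo-*)
  open RingProperties ring using (-1*x≈-x; -‿involutive; -0#≈0#)

  ≤-preorder : Preorder c ℓ₁ ℓ₂
  ≤-preorder = record { isPreorder = O.isPreorder }

  module ≤-Reasoning = PreorderReasoning ≤-preorder
  open ≤-Reasoning

  open GroupProperties +-group public using ()
    renaming (//-rightDividesˡ to [y-x]+x≈y; //-rightDividesʳ to [y+x]-x≈y)
  open CommutativeSemigroupProperties (CommutativeMonoid.commutativeSemigroup +-commutativeMonoid) public
    using (x∙yz≈y∙xz; xy∙z≈yz∙x)

  +-mono-≤ : ∀ {x y u v} → x ≤ y → u ≤ v → x + u ≤ y + v
  +-mono-≤ {x} {y} {u} {v} x≤y u≤v = begin
    x + u ≲⟨ +-monoˡ-≤ u x≤y ⟩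
    y + u ≈⟨ +-comm y u ⟩
    u + y ≲⟨ +-monoˡ-≤ y u≤v ⟩
    v + y ≈⟨ +-comm v y ⟩
    y + v ∎

  +-cancelʳ-≤ : ∀ z {x y} → x + z ≤ y + z → x ≤ y
  +-cancelʳ-≤ z {x} {y} x+z≤y+z = begin
    x           ≈⟨ [y+x]-x≈y z x ⟨
    x + z + - z ≲⟨ +-monoˡ-≤ (- z) x+z≤y+z ⟩
    y + z + - z ≈⟨ [y+x]-x≈y z y ⟩
    y           ∎

  *-monoˡ-≤ : ∀ {z} → 0# ≤ z → ∀ {x y} → x ≤ y → z * x ≤ z * y
  *-monoˡ-≤ {z} 0≤z {x} {y} x≤y = begin
    z * x                     ≈⟨ +-identityˡ (z * x) ⟨
    0# + z * x                ≲⟨ +-monoˡ-≤ (z * x) (*-nonNegative 0≤z 0≤y-x) ⟩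
    z * (y + - x) + z * x     ≈⟨ distribˡ z (y + - x) x ⟨
    z * (y + - x + x)         ≈⟨ *-congˡ ([y-x]+x≈y x y) ⟩
    z * y                     ∎
    where
    0≤y-x : 0# ≤ y + - x
    0≤y-x = begin
      0#      ≈⟨ -‿inverseʳ x ⟨
      x + - x ≲⟨ +-monoˡ-≤ (- x) x≤y ⟩
      y + - x ∎

  0≤1 : 0# ≤ 1#
  0≤1 with O.total 0# 1#
  ... | inj₁ 0≤1 = 0≤1
  ... | inj₂ 1≤0 = begin
    0#            ≲⟨ *-nonNegative 0≤-1 0≤-1 ⟩
    - 1# * - 1#   ≈⟨ -1*x≈-x (- 1#) ⟩
    - - 1#        ≈⟨ -‿involutive 1# ⟩
    1#            ∎
    where
    0≤-1 : 0# ≤ - 1#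
    0≤-1 = begin
      0#        ≈⟨ -‿inverseʳ 1# ⟨
      1# + - 1# ≲⟨ +-monoˡ-≤ (- 1#) 1≤0 ⟩
      0# + - 1# ≈⟨ +-identityˡ (- 1#) ⟩
      - 1#      ∎

  fromℕ-+ : ∀ m n → fromℕ (m ℕ.+ n) ≈ fromℕ m + fromℕ n
  fromℕ-+ = ×-homo-+ 1#

  fromℕ-* : ∀ m n → fromℕ (m ℕ.* n) ≈ fromℕ m * fromℕ n
  fromℕ-* = ×1-homo-*

  0≤fromℕ : ∀ n → 0# ≤ fromℕ n
  0≤fromℕ zero    = O.refl
  0≤fromℕ (suc n) = begin
    0#             ≈⟨ +-identityˡ 0# ⟨
    0# + 0#        ≲⟨ +-mono-≤ 0≤1 (0≤fromℕ n) ⟩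
    1# + fromℕ n   ∎

  fromℕ-mono-≤ : ∀ {m n} → m ℕ.≤ n → fromℕ m ≤ fromℕ n
  fromℕ-mono-≤ {n = n} z≤n = 0≤fromℕ n
  fromℕ-mono-≤ (s≤s m≤n)   = +-mono-≤ O.refl (fromℕ-mono-≤ m≤n)

  1≰0 : ¬ (1# ≤ 0#)
  1≰0 1≤0 = 0#≉1# (O.antisym 0≤1 1≤0)

  fromℕ-cancel-≤ : ∀ {m n} → fromℕ m ≤ fromℕ n → m ℕ.≤ n
  fromℕ-cancel-≤ {m} {n} le with m ℕ.≤? n
  ... | yes m≤n = m≤n
  ... | no  m≰n = contradiction (+-cancelʳ-≤ (fromℕ n) (begin
    1# + fromℕ n ≲⟨ fromℕ-mono-≤ (ℕₚ.≰⇒> m≰n) ⟩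
    fromℕ m      ≲⟨ le ⟩
    fromℕ n      ≈⟨ +-identityˡ (fromℕ n) ⟨
    0# + fromℕ n ∎)) 1≰0

  fromℕ[1+n]≉0 : ∀ n → ¬ (fromℕ (suc n) ≈ 0#)
  fromℕ[1+n]≉0 n eq with fromℕ-cancel-≤ {suc n} {0} (O.reflexive eq)
  ... | ()

  fromℤ-⊖ : ∀ m n → fromℤ (m ⊖ n) ≈ fromℕ m - fromℕ n
  fromℤ-⊖ m zero = begin-equality
    fromℕ m       ≈⟨ +-identityʳ (fromℕ m) ⟨
    fromℕ m + 0#  ≈⟨ +-congˡ -0#≈0# ⟨
    fromℕ m - 0#  ∎
  fromℤ-⊖ zero    (suc n) = sym (+-identityˡ _)
  fromℤ-⊖ (suc m) (suc n) rewrite ℤₚ.[1+m]⊖[1+n]≡m⊖n m n = begin-equality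
    z                                      ≈⟨ [y+x]-x≈y (1# + fromℕ n) z ⟨
    (z + (1# + fromℕ n)) - (1# + fromℕ n)  ≈⟨ +-congʳ (x∙yz≈y∙xz z 1# (fromℕ n)) ⟩
    (1# + (z + fromℕ n)) - (1# + fromℕ n)  ≈⟨ +-congʳ (+-congˡ (+-congʳ (fromℤ-⊖ m n))) ⟩
    (1# + (fromℕ m - fromℕ n + fromℕ n)) - (1# + fromℕ n)
                                           ≈⟨ +-congʳ (+-congˡ ([y-x]+x≈y (fromℕ n) (fromℕ m))) ⟩
    (1# + fromℕ m) - (1# + fromℕ n)        ∎
    where z = fromℤ (m ⊖ n)

-- Comparison of counts up to the factor ε

module Scaled {c ℓ₁ ℓ₂} (F : OrderedField c ℓ₁ ℓ₂) (ε : OrderedField.Carrier F)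
  (0<ε : OrderedField._<_ F (OrderedField.0# F) ε)
  (ε<1/121 : OrderedField._<_ F ε (OrderedField._⁻¹ F (OrderedField.fromℕ F 121))) where

  open OrderedField F
  open OrderedFieldProperties F
  open ≤-Reasoning
  private module O = IsDecTotalOrder isDecTotalOrder

  0≤ε : 0# ≤ ε
  0≤ε = proj₁ 0<ε

  ε*ε⁻¹≈1 : ε * ε ⁻¹ ≈ 1#
  ε*ε⁻¹≈1 = *-inverseʳ (λ ε≈0 → proj₂ 0<ε (sym ε≈0))

  121ε≤1 : fromℕ 121 * ε ≤ 1#
  121ε≤1 = begin
    fromℕ 121 * ε              ≲⟨ *-monoˡ-≤ (0≤fromℕ 121) (proj₁ ε<1/121) ⟩
    fromℕ 121 * fromℕ 121 ⁻¹   ≈⟨ *-inverseʳ (fromℕ[1+n]≉0 120) ⟩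
    1#                         ∎

  infix 4 _≼_

  -- A record, like Dense and _∈±w_ below, so that its arguments can be inferred:
  -- fromℕ cannot be inverted by unification.
  record _≼_ (a b : ℕ) : Set ℓ₂ where
    constructor ⟪_⟫
    field un≼ : fromℕ a ≤ ε * fromℕ b

  _≼?_ : ∀ a b → Dec (a ≼ b)
  a ≼? b = map′ ⟪_⟫ _≼_.un≼ (fromℕ a O.≤? ε * fromℕ b)

  0≼ : ∀ b → 0 ≼ b
  0≼ b = ⟪ *-nonNegative 0≤ε (0≤fromℕ b) ⟫

  ≼-monoˡ : ∀ {a a′ b} → a′ ℕ.≤ a → a ≼ b → a′ ≼ b
  ≼-monoˡ a′≤a ⟪ a≼b ⟫ = ⟪ O.trans (fromℕ-mono-≤ a′≤a) a≼b ⟫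

  ≼-monoʳ : ∀ {a b b′} → b ℕ.≤ b′ → a ≼ b → a ≼ b′
  ≼-monoʳ b≤b′ ⟪ a≼b ⟫ = ⟪ O.trans a≼b (*-monoˡ-≤ 0≤ε (fromℕ-mono-≤ b≤b′)) ⟫

  ≼-+ : ∀ {a b a′ b′} → a ≼ b → a′ ≼ b′ → a ℕ.+ a′ ≼ b ℕ.+ b′
  ≼-+ {a} {b} {a′} {b′} ⟪ a≼b ⟫ ⟪ a′≼b′ ⟫ = ⟪ begin
    fromℕ (a ℕ.+ a′)            ≈⟨ fromℕ-+ a a′ ⟩
    fromℕ a + fromℕ a′          ≲⟨ +-mono-≤ a≼b a′≼b′ ⟩
    ε * fromℕ b + ε * fromℕ b′  ≈⟨ distribˡ ε (fromℕ b) (fromℕ b′) ⟨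
    ε * (fromℕ b + fromℕ b′)    ≈⟨ *-congˡ (fromℕ-+ b b′) ⟨
    ε * fromℕ (b ℕ.+ b′)        ∎ ⟫

  ≼-* : ∀ k {a b} → a ≼ b → k ℕ.* a ≼ k ℕ.* b
  ≼-* zero    a≼b = 0≼ 0
  ≼-* (suc k) a≼b = ≼-+ a≼b (≼-* k a≼b)

  -- The upper bound on ε acts through this lemma: it turns a comparison in the field into one in ℕ,
  -- where the costs of blocks are estimated.
  ≼⇒121*≤ : ∀ {a b} → a ≼ b → 121 ℕ.* a ℕ.≤ b
  ≼⇒121*≤ {a} {b} ⟪ a≼b ⟫ = fromℕ-cancel-≤ (begin
    fromℕ (121 ℕ.* a)           ≈⟨ fromℕ-* 121 a ⟩
    fromℕ 121 * fromℕ a         ≲⟨ *-monoˡ-≤ (0≤fromℕ 121) a≼b ⟩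
    fromℕ 121 * (ε * fromℕ b)   ≈⟨ *-assoc (fromℕ 121) ε (fromℕ b) ⟨
    fromℕ 121 * ε * fromℕ b     ≈⟨ *-comm (fromℕ 121 * ε) (fromℕ b) ⟩
    fromℕ b * (fromℕ 121 * ε)   ≲⟨ *-monoˡ-≤ (0≤fromℕ b) 121ε≤1 ⟩
    fromℕ b * 1#                ≈⟨ *-identityʳ (fromℕ b) ⟩
    fromℕ b                     ∎)

  record Dense (a b : ℕ) : Set ℓ₂ where
    constructor ⟪_⟫
    field unDense : ε * fromℕ b ≤ fromℕ a

  -- The alternatives overlap at equality, so totality of the order is enough.
  dense-or-≼ : ∀ a b → Dense a b ⊎ a ≼ b
  dense-or-≼ a b = Sum.map ⟪_⟫ ⟪_⟫ (O.total (ε * fromℕ b) (fromℕ a))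

  -- With `a = 0` and `b` positive, ε would have to vanish. This supplies the edge that becomes the
  -- witness of a good block.
  dense⇒>0 : ∀ {a b} → 0 ℕ.< b → Dense a b → 0 ℕ.< a
  dense⇒>0 {suc a} _ _ = s≤s z≤n
  dense⇒>0 {zero} {b} 0<b ⟪ dense ⟫ = contradiction (begin
    1#            ≈⟨ ε*ε⁻¹≈1 ⟨
    ε * ε ⁻¹      ≈⟨ *-congʳ ε≈0 ⟩
    0# * ε ⁻¹     ≈⟨ zeroˡ (ε ⁻¹) ⟩
    0#            ∎) 1≰0
    where
    ε≈0 : ε ≈ 0#
    ε≈0 = O.antisym (begin
      ε             ≈⟨ *-identityʳ ε ⟨
      ε * 1#        ≈⟨ *-congˡ (+-identityʳ 1#) ⟨
      ε * fromℕ 1   ≲⟨ *-monoˡ-≤ 0≤ε (fromℕ-mono-≤ 0<b) ⟩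
      ε * fromℕ b   ≲⟨ dense ⟩
      0#            ∎) 0≤ε

  -- Multiplying w ≤ t by ε gives the second case the form `1 ≼ t`, which can then be scaled by a
  -- block length.
  ≤w-or-1≼ : ∀ t → fromℕ t ≤ ε ⁻¹ ⊎ 1 ≼ t
  ≤w-or-1≼ t with O.total (fromℕ t) (ε ⁻¹)
  ... | inj₁ t≤w = inj₁ t≤w
  ... | inj₂ w≤t = inj₂ ⟪ (begin
    fromℕ 1      ≈⟨ +-identityʳ 1# ⟩
    1#           ≈⟨ ε*ε⁻¹≈1 ⟨
    ε * ε ⁻¹     ≲⟨ *-monoˡ-≤ 0≤ε w≤t ⟩
    ε * fromℕ t  ∎) ⟫

  -- Here `l` counts the matched and `a` the unmatched symbols of a word of length `n`; matching an
  -- ε-fraction leaves at most the decoding radius.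
  dense⇒corruption : ∀ {a l n} → Dense l n → a ℕ.+ l ≡ n → fromℕ a ≤ fromℕ n * (1# - ε)
  dense⇒corruption {a} {l} {n} ⟪ dense ⟫ ≡.refl = +-cancelʳ-≤ (ε * fromℕ n) (begin
    fromℕ a + ε * fromℕ n                         ≲⟨ +-mono-≤ O.refl dense ⟩
    fromℕ a + fromℕ l                             ≈⟨ fromℕ-+ a l ⟨
    fromℕ n                                       ≈⟨ *-identityʳ (fromℕ n) ⟨
    fromℕ n * 1#                                  ≈⟨ *-congˡ ([y-x]+x≈y ε 1#) ⟨
    fromℕ n * (1# - ε + ε)                        ≈⟨ distribˡ (fromℕ n) (1# - ε) ε ⟩
    fromℕ n * (1# - ε) + fromℕ n * ε              ≈⟨ +-congˡ (*-comm (fromℕ n) ε) ⟩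
    fromℕ n * (1# - ε) + ε * fromℕ n              ∎)

  approximation : ∀ {l d e} → l ℕ.≤ d ℕ.+ e → e ≼ 23 ℕ.* d →
                  fromℕ l ≤ (1# + fromℕ 23 * ε) * fromℕ d
  approximation {l} {d} {e} l≤d+e ⟪ e≼23d ⟫ = begin
    fromℕ l                                   ≲⟨ fromℕ-mono-≤ l≤d+e ⟩
    fromℕ (d ℕ.+ e)                           ≈⟨ fromℕ-+ d e ⟩
    fromℕ d + fromℕ e                         ≲⟨ +-mono-≤ O.refl e≼23d ⟩
    fromℕ d + ε * fromℕ (23 ℕ.* d)            ≈⟨ +-cong (sym (*-identityˡ (fromℕ d))) (*-congˡ (fromℕ-* 23 d)) ⟩
    1# * fromℕ d + ε * (fromℕ 23 * fromℕ d)   ≈⟨ +-congˡ (trans (*-congʳ (*-comm (fromℕ 23) ε)) (*-assoc ε (fromℕ 23) (fromℕ d))) ⟨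
    1# * fromℕ d + fromℕ 23 * ε * fromℕ d     ≈⟨ distribʳ (fromℕ d) 1# (fromℕ 23 * ε) ⟨
    (1# + fromℕ 23 * ε) * fromℕ d             ∎

  infix 4 _∈±w_

  record _∈±w_ (a b : ℕ) : Set ℓ₂ where
    constructor _,_
    field
      upper : fromℕ a ≤ fromℕ b + ε ⁻¹
      lower : fromℕ b ≤ fromℕ a + ε ⁻¹

  within-t⇒∈±w : ∀ {a b t} → fromℕ t ≤ ε ⁻¹ → a ℕ.≤ b ℕ.+ t → b ℕ.≤ a ℕ.+ t → a ∈±w b
  within-t⇒∈±w {t = t} t≤w a≤b+t b≤a+t = bound a≤b+t , bound b≤a+t
    where
    bound : ∀ {a b} → a ℕ.≤ b ℕ.+ t → fromℕ a ≤ fromℕ b + ε ⁻¹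
    bound {a} {b} a≤b+t = begin
      fromℕ a               ≲⟨ fromℕ-mono-≤ a≤b+t ⟩
      fromℕ (b ℕ.+ t)       ≈⟨ fromℕ-+ b t ⟩
      fromℕ b + fromℕ t     ≲⟨ +-mono-≤ O.refl t≤w ⟩
      fromℕ b + ε ⁻¹        ∎

  -- A shift of origin by `s`, the number of sub-blocks in front of the block from which `k′` is
  -- counted; `a ⊖ s` may be negative. With `s = 0` it also serves the loop over `k`.
  ∈±w⇒⊖∈ : ∀ {a s j} → a ∈±w (s ℕ.+ j) →
    fromℕ j - ε ⁻¹ ≤ fromℤ (a ⊖ s) × fromℤ (a ⊖ s) ≤ fromℕ j + ε ⁻¹
  ∈±w⇒⊖∈ {a} {s} {j} (upper , lower) =
      +-cancelʳ-≤ (fromℕ s + ε ⁻¹) (begin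
        (fromℕ j - ε ⁻¹) + (fromℕ s + ε ⁻¹)         ≈⟨ x∙yz≈y∙xz (fromℕ j - ε ⁻¹) (fromℕ s) (ε ⁻¹) ⟩
        fromℕ s + (fromℕ j - ε ⁻¹ + ε ⁻¹)           ≈⟨ +-congˡ ([y-x]+x≈y (ε ⁻¹) (fromℕ j)) ⟩
        fromℕ s + fromℕ j                           ≈⟨ fromℕ-+ s j ⟨
        fromℕ (s ℕ.+ j)                             ≲⟨ lower ⟩
        fromℕ a + ε ⁻¹                              ≈⟨ +-congʳ ([y-x]+x≈y (fromℕ s) (fromℕ a)) ⟨
        (fromℕ a - fromℕ s + fromℕ s) + ε ⁻¹        ≈⟨ +-assoc _ (fromℕ s) (ε ⁻¹) ⟩
        (fromℕ a - fromℕ s) + (fromℕ s + ε ⁻¹)      ≈⟨ +-congʳ (fromℤ-⊖ a s) ⟨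
        fromℤ (a ⊖ s) + (fromℕ s + ε ⁻¹)            ∎)
    , +-cancelʳ-≤ (fromℕ s) (begin
        fromℤ (a ⊖ s) + fromℕ s                     ≈⟨ +-congʳ (fromℤ-⊖ a s) ⟩
        (fromℕ a - fromℕ s) + fromℕ s               ≈⟨ [y-x]+x≈y (fromℕ s) (fromℕ a) ⟩
        fromℕ a                                     ≲⟨ upper ⟩
        fromℕ (s ℕ.+ j) + ε ⁻¹                      ≈⟨ +-congʳ (fromℕ-+ s j) ⟩
        (fromℕ s + fromℕ j) + ε ⁻¹                  ≈⟨ xy∙z≈yz∙x (fromℕ s) (fromℕ j) (ε ⁻¹) ⟩
        (fromℕ j + ε ⁻¹) + fromℕ s                  ∎)

open ≡ using (refl; sym; trans; cong; cong₂; subst; subst₂; module ≡-Reasoning)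

-- Operations of a matching

-- Identifies the positions that filtering `allFin n` retains with the endpoints of a matching, in
-- the same order.
strictlySorted-unique : ∀ {n} {xs ys : List (Fin n)} →
  AllPairs Fin._<_ xs → AllPairs Fin._<_ ys →
  (∀ {z} → z ∈ xs → z ∈ ys) → (∀ {z} → z ∈ ys → z ∈ xs) → xs ≡ ys
strictlySorted-unique [] [] _ _ = refl
strictlySorted-unique [] (_ ∷ _) _ ⊇ with () ← ⊇ (here refl)
strictlySorted-unique (_ ∷ _) [] ⊆ _ with () ← ⊆ (here refl)
strictlySorted-unique {xs = x ∷ xs} {y ∷ ys} (x<xs ∷ xs↗) (y<ys ∷ ys↗) ⊆ ⊇ =
  cong₂ _∷_ x≡y (strictlySorted-unique xs↗ ys↗
    (λ z∈ → tail ⊆ x<xs x≡y z∈) (λ z∈ → tail ⊇ y<ys (sym x≡y) z∈))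
  where
  x≡y : x ≡ y
  x≡y with ⊆ (here refl) | ⊇ (here refl)
  ... | here x≡y   | _          = x≡y
  ... | there _    | here y≡x   = sym y≡x
  ... | there x∈ys | there y∈xs =
    contradiction (All.lookup y<ys x∈ys) (Finₚ.<-asym (All.lookup x<xs y∈xs))

  tail : ∀ {n} {u v : Fin n} {us vs} → (∀ {z} → z ∈ u ∷ us → z ∈ v ∷ vs) →
         All (u Fin.<_) us → u ≡ v → ∀ {z} → z ∈ us → z ∈ vs
  tail ⊆′ u<us u≡v z∈ with ⊆′ (there z∈)
  ... | here z≡v = contradiction (trans u≡v (sym z≡v)) (Finₚ.<⇒≢ (All.lookup u<us z∈))
  ... | there z∈vs = z∈vs

sorted-length : ∀ {a} {A : Set a} (f : A → ℕ) {lo hi xs} →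
  AllPairs (ℕ._<_ on f) xs → All (λ x → lo ℕ.≤ f x × f x ℕ.< hi) xs → lo ℕ.≤ hi →
  lo ℕ.+ length xs ℕ.≤ hi
sorted-length f {lo} [] [] lo≤hi = ℕₚ.≤-trans (ℕₚ.≤-reflexive (ℕₚ.+-identityʳ lo)) lo≤hi
sorted-length f {lo} (x< ∷ xs↗) ((lo≤x , x<hi) ∷ bounds) lo≤hi =
  ℕₚ.≤-trans (ℕₚ.≤-reflexive (ℕₚ.+-suc lo _))
    (sorted-length f xs↗
      (All.zipWith (λ (x<y , _ , y<hi) → ℕₚ.≤-<-trans lo≤x x<y , y<hi) (x< , bounds))
      (ℕₚ.≤-<-trans lo≤x x<hi))

length-filter-¬ : ∀ {a p} {A : Set a} {P : Pred A p} (P? : Decidable P) xs →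
  length (filter (¬? ∘ P?) xs) ℕ.+ length (filter P? xs) ≡ length xs
length-filter-¬ P? [] = refl
length-filter-¬ P? (x ∷ xs) with P? x
... | yes _ = trans (ℕₚ.+-suc _ _) (cong suc (length-filter-¬ P? xs))
... | no _  = cong suc (length-filter-¬ P? xs)

module _ {a} {A : Set a} where

  infixr 5 _◅◅_

  _◅◅_ : ∀ {xs ys zs : List A} {os ps} →
         xs ═⟨ os ⟩⇒ ys → ys ═⟨ ps ⟩⇒ zs → xs ═⟨ os ++ ps ⟩⇒ zs
  []       ◅◅ ts = ts
  (s ∷ ss) ◅◅ ts = s ∷ (ss ◅◅ ts)

  private
    shift : ∀ us {x : A} {k} (i : Fin k) →
            length us ℕ.+ suc (toℕ i) ≡ length (us List.∷ʳ x) ℕ.+ toℕ i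
    shift us i = trans (ℕₚ.+-suc (length us) (toℕ i))
      (cong (ℕ._+ toℕ i) (sym (trans (Listₚ.length-++ us) (ℕₚ.+-comm (length us) 1))))

  module _ {b p} {B : Set b} (position : B → ℕ) (symbol : B → A)
           {P : Pred B p} (P? : Decidable P) where

    -- The operations leave the prefix `us` alone. The induction hypothesis counts `x` as part of it
    -- even if `x` is to be deleted: deletions run from right to left, so `x` is still present while
    -- the rest is treated and goes last.
    delete-filter : ∀ {k} us (X : Vec A k) (f : Fin k → B) →
      (∀ i → position (f i) ≡ length us ℕ.+ toℕ i) → (∀ i → symbol (f i) ≡ lookup X i) →
      us ++ toList X
        ═⟨ List.map (delete ∘ position) (reverse (filter (¬? ∘ P?) (List.tabulate f))) ⟩⇒
      us ++ List.map symbol (filter P? (List.tabulate f))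
    delete-filter us [] f _ _ = []
    delete-filter us (x ∷ X) f pos sym-f
      with ih ← delete-filter (us List.∷ʳ x) X (f ∘ suc)
                  (λ i → trans (pos (suc i)) (shift us i))
                  (sym-f ∘ suc)
      rewrite Listₚ.∷ʳ-++ us x (toList X)
            | Listₚ.∷ʳ-++ us x (List.map symbol (filter P? (List.tabulate (f ∘ suc))))
      with P? (f zero)
    ... | yes _ rewrite sym-f zero = ih
    ... | no _ rewrite Listₚ.unfold-reverse (f zero) (filter (¬? ∘ P?) (List.tabulate (f ∘ suc)))
                     | Listₚ.map-++ (Op.delete {A = A} ∘ position)
                         (reverse (filter (¬? ∘ P?) (List.tabulate (f ∘ suc)))) (f zero ∷ [])
                     | trans (pos zero) (ℕₚ.+-identityʳ _) =
      ih ◅◅ (delete us x _ ∷ [])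

    -- Here `us` is the finished part of the target: insertions run from left to right, so an
    -- unmatched `y` is put in before the induction hypothesis applies.
    insert-filter : ∀ {k} us (Y : Vec A k) (f : Fin k → B) →
      (∀ i → position (f i) ≡ length us ℕ.+ toℕ i) → (∀ i → symbol (f i) ≡ lookup Y i) →
      us ++ List.map symbol (filter P? (List.tabulate f))
        ═⟨ List.map (λ q → insert (position q) (symbol q)) (filter (¬? ∘ P?) (List.tabulate f)) ⟩⇒
      us ++ toList Y
    insert-filter us [] f _ _ = []
    insert-filter us (y ∷ Y) f pos sym-f
      with ih ← insert-filter (us List.∷ʳ y) Y (f ∘ suc)
                  (λ i → trans (pos (suc i)) (shift us i))
                  (sym-f ∘ suc)
      rewrite Listₚ.∷ʳ-++ us y (toList Y)
            | Listₚ.∷ʳ-++ us y (List.map symbol (filter P? (List.tabulate (f ∘ suc))))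
      with P? (f zero)
    ... | yes _ rewrite sym-f zero = ih
    ... | no _ rewrite sym-f zero | trans (pos zero) (ℕₚ.+-identityʳ _) = insert us y _ ∷ ih

module _ {n : ℕ} {ps : List (Fin n)} (ps↗ : AllPairs Fin._<_ ps) where
  open DecMembership (Finₚ._≟_ {n}) using (_∈?_)

  matched≡ : filter (_∈? ps) (allFin n) ≡ ps
  matched≡ = strictlySorted-unique
    (AllPairsₚ.filter⁺ (_∈? ps) (AllPairsₚ.tabulate⁺-< id)) ps↗
    (proj₂ ∘ ∈ₚ.∈-filter⁻ (_∈? ps) {xs = allFin n})
    (∈ₚ.∈-filter⁺ (_∈? ps) (∈ₚ.∈-allFin _))

  length-unmatched : length (unmatched ps) ℕ.+ length ps ≡ n
  length-unmatched = trans
    (cong (λ qs → length (unmatched ps) ℕ.+ length qs) (sym matched≡))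
    (trans (length-filter-¬ (_∈? ps) (allFin n)) (Listₚ.length-tabulate id))

module _ {a} {A : Set a} {m n : ℕ} (X : Vec A m) (Y : Vec A n) where

  Same : Fin m → Fin n → Set a
  Same p q = lookup X p ≡ lookup Y q

module _ {a} {A : Set a} {m n : ℕ} (X : Vec A m) (Y : Vec A n) {M : List (Fin m × Fin n)}
         (M↗ : NonCrossingMatching (Same X Y) M) where

  private
    ps = List.map proj₁ M
    qs = List.map proj₂ M

    ps↗ : AllPairs Fin._<_ ps
    ps↗ = AllPairsₚ.map⁺ (AllPairs.map proj₁ (proj₂ M↗))

    qs↗ : AllPairs Fin._<_ qs
    qs↗ = AllPairsₚ.map⁺ (AllPairs.map proj₂ (proj₂ M↗))

    symbols≡ : ∀ {M} → All (uncurry (Same X Y)) M →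
               List.map (lookup X) (List.map proj₁ M) ≡ List.map (lookup Y) (List.map proj₂ M)
    symbols≡ []       = refl
    symbols≡ (s ∷ ss) = cong₂ _∷_ s (symbols≡ ss)

    open DecMembership (Finₚ._≟_ {m}) using () renaming (_∈?_ to _∈X?_)
    open DecMembership (Finₚ._≟_ {n}) using () renaming (_∈?_ to _∈Y?_)

  operations-correct : toList X ═⟨ operations X Y M ⟩⇒ toList Y
  operations-correct = deletions ◅◅ insertions
    where
    deletions : toList X ═⟨ List.map (delete ∘ toℕ) (reverse (unmatched ps)) ⟩⇒ List.map (lookup X) ps
    deletions = subst (λ zs → toList X ═⟨ List.map (delete ∘ toℕ) (reverse (unmatched ps)) ⟩⇒ List.map (lookup X) zs)
      (matched≡ ps↗) (delete-filter toℕ (lookup X) (_∈X? ps) [] X id (λ _ → refl) (λ _ → refl))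
    insertions : List.map (lookup X) ps
      ═⟨ List.map (λ q → insert (toℕ q) (lookup Y q)) (unmatched qs) ⟩⇒ toList Y
    insertions = subst (_═⟨ List.map (λ q → insert (toℕ q) (lookup Y q)) (unmatched qs) ⟩⇒ toList Y)
      (trans (cong (List.map (lookup Y)) (matched≡ qs↗)) (sym (symbols≡ (proj₁ M↗))))
      (insert-filter toℕ (lookup Y) (_∈Y? qs) [] Y id (λ _ → refl) (λ _ → refl))

  private
    #deletions-map : ∀ (ps : List (Fin m)) (rs : List (Fin n)) →
      #deletions (List.map (delete ∘ toℕ) ps ++ List.map (λ q → insert (toℕ q) (lookup Y q)) rs)
        ≡ length ps
    #deletions-map []       []       = refl
    #deletions-map []       (_ ∷ rs) = #deletions-map [] rs
    #deletions-map (_ ∷ ps) rs       = cong suc (#deletions-map ps rs)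

    #insertions-map : ∀ (ps : List (Fin m)) (rs : List (Fin n)) →
      #insertions (List.map (delete ∘ toℕ) ps ++ List.map (λ q → insert (toℕ q) (lookup Y q)) rs)
        ≡ length rs
    #insertions-map []       []       = refl
    #insertions-map []       (_ ∷ rs) = cong suc (#insertions-map [] rs)
    #insertions-map (_ ∷ ps) rs       = #insertions-map ps rs

  #deletions-operations : #deletions (operations X Y M) ℕ.+ length M ≡ m
  #deletions-operations = trans (cong₂ ℕ._+_
      (trans (#deletions-map (reverse (unmatched ps)) (unmatched qs)) (Listₚ.length-reverse (unmatched ps)))
      (sym (Listₚ.length-map proj₁ M)))
    (length-unmatched ps↗)

  #insertions-operations : #insertions (operations X Y M) ℕ.+ length M ≡ n
  #insertions-operations = trans (cong₂ ℕ._+_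
      (#insertions-map (reverse (unmatched ps)) (unmatched qs)) (sym (Listₚ.length-map proj₂ M)))
    (length-unmatched qs↗)

length-ops : ∀ {a} {A : Set a} (os : List (Op A)) → length os ≡ #deletions os ℕ.+ #insertions os
length-ops [] = refl
length-ops (delete _ ∷ os) = cong suc (length-ops os)
length-ops (insert _ _ ∷ os) = trans (cong suc (length-ops os)) (sym (ℕₚ.+-suc _ _))

-- Optimal alignments and largest matchings

module _ {a} {A : Set a} where

  -- The index c counts the unmatched symbols of both strings.
  data Alignment : List A → List A → ℕ → Set a where
    []   : Alignment [] [] 0
    keep : ∀ {xs ys c} x → Alignment xs ys c → Alignment (x ∷ xs) (x ∷ ys) c
    drop : ∀ {xs ys c} x → Alignment xs ys c → Alignment (x ∷ xs) ys (suc c)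
    add  : ∀ {xs ys c} y → Alignment xs ys c → Alignment xs (y ∷ ys) (suc c)

  alignment-refl : ∀ xs → Alignment xs xs 0
  alignment-refl []       = []
  alignment-refl (x ∷ xs) = keep x (alignment-refl xs)

  delete-alignment : ∀ us {x vs ys c} → Alignment (us ++ vs) ys c →
                     Alignment (us ++ x ∷ vs) ys (suc c)
  delete-alignment []       al         = drop _ al
  delete-alignment (u ∷ us) (keep u al) = keep u (delete-alignment us al)
  delete-alignment (u ∷ us) (drop u al) = drop u (delete-alignment us al)
  delete-alignment (u ∷ us) (add y al)  = add y (delete-alignment (u ∷ us) al)

  -- Operations are undone from the last to the first. If the inserted `x` was kept, its partner
  -- turns into an `add`; if it was dropped, the cost falls by one, hence an inequality.
  insert-alignment : ∀ us {x vs ys c} → Alignment (us ++ x ∷ vs) ys c →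
                     ∃[ c′ ] (c′ ℕ.≤ suc c × Alignment (us ++ vs) ys c′)
  insert-alignment []       (keep x al) = _ , ℕₚ.≤-refl , add x al
  insert-alignment []       (drop x al) = _ , ℕₚ.≤-trans (ℕₚ.n≤1+n _) (ℕₚ.n≤1+n _) , al
  insert-alignment (u ∷ us) (keep u al) = Product.map₂ (Product.map₂ (keep u)) (insert-alignment us al)
  insert-alignment (u ∷ us) (drop u al) = Product.map suc (Product.map s≤s (drop u)) (insert-alignment us al)
  insert-alignment []       (add y al)  = Product.map suc (Product.map s≤s (add y)) (insert-alignment [] al)
  insert-alignment (u ∷ us) (add y al)  = Product.map suc (Product.map s≤s (add y)) (insert-alignment (u ∷ us) al)

  operations⇒alignment : ∀ {xs ys os} → xs ═⟨ os ⟩⇒ ys →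
                         ∃[ c ] (c ℕ.≤ length os × Alignment xs ys c)
  operations⇒alignment [] = 0 , z≤n , alignment-refl _
  operations⇒alignment (delete us x vs ∷ ss) =
    Product.map suc (Product.map s≤s (delete-alignment us)) (operations⇒alignment ss)
  operations⇒alignment (insert us x vs ∷ ss) with operations⇒alignment ss
  ... | c , c≤ , al with insert-alignment us al
  ...   | c′ , c′≤ , al′ = c′ , ℕₚ.≤-trans c′≤ (s≤s c≤) , al′

  -- A kept pair accounts for two symbols, any other symbol for one unit of `c`. The resulting
  -- equation converts between edit costs and sizes of matchings.
  alignment⇒matching : ∀ {m n xs ys c} → Alignment xs ys c →
    (X : Vec A m) (Y : Vec A n) → xs ≡ toList X → ys ≡ toList Y →
    ∃[ M ] (NonCrossingMatching (Same X Y) M × m ℕ.+ n ≡ c ℕ.+ 2 ℕ.* length M)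
  alignment⇒matching [] [] [] _ _ = [] , ([] , []) , refl
  alignment⇒matching {suc m} {suc n} {c = c} (keep x al) (x ∷ X) (x ∷ Y) refl refl
    with alignment⇒matching al X Y refl refl
  ... | M , (sames , M↗) , eq =
      (zero , zero) ∷ List.map (Product.map suc suc) M
    , (refl ∷ Allₚ.map⁺ sames
      , Allₚ.map⁺ (All.universal (λ _ → ℕ.z<s , ℕ.z<s) M)
        ∷ AllPairsₚ.map⁺ (AllPairs.map (Product.map s≤s s≤s) M↗))
    , (begin
        suc m ℕ.+ suc n                ≡⟨ cong suc (ℕₚ.+-suc m n) ⟩
        2 ℕ.+ (m ℕ.+ n)                ≡⟨ cong (2 ℕ.+_) eq ⟩
        2 ℕ.+ (c ℕ.+ 2 ℕ.* length M)   ≡⟨ ℕₚ.+-assoc 2 c _ ⟨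
        (2 ℕ.+ c) ℕ.+ 2 ℕ.* length M   ≡⟨ cong (ℕ._+ 2 ℕ.* length M) (ℕₚ.+-comm 2 c) ⟩
        (c ℕ.+ 2) ℕ.+ 2 ℕ.* length M   ≡⟨ ℕₚ.+-assoc c 2 _ ⟩
        c ℕ.+ (2 ℕ.+ 2 ℕ.* length M)   ≡⟨ cong (c ℕ.+_) (ℕₚ.*-suc 2 _) ⟨
        c ℕ.+ 2 ℕ.* suc (length M)     ≡⟨ cong (λ l → c ℕ.+ 2 ℕ.* suc l) (Listₚ.length-map _ M) ⟨
        _ ∎)
    where open ≡-Reasoning
  alignment⇒matching {c = suc c} (drop x al) (x ∷ X) Y refl eqY
    with alignment⇒matching al X Y refl eqY
  ... | M , (sames , M↗) , eq =
      List.map (Product.map₁ suc) M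
    , (Allₚ.map⁺ sames , AllPairsₚ.map⁺ (AllPairs.map (Product.map₁ s≤s) M↗))
    , cong suc (trans eq (cong (λ l → c ℕ.+ 2 ℕ.* l) (sym (Listₚ.length-map _ M))))
  alignment⇒matching {m} {c = suc c} (add y al) X (y ∷ Y) eqX refl
    with alignment⇒matching al X Y eqX refl
  ... | M , (sames , M↗) , eq =
      List.map (Product.map₂ suc) M
    , (Allₚ.map⁺ sames , AllPairsₚ.map⁺ (AllPairs.map (Product.map₂ s≤s) M↗))
    , trans (ℕₚ.+-suc m _) (cong suc (trans eq (cong (λ l → c ℕ.+ 2 ℕ.* l) (sym (Listₚ.length-map _ M)))))

-- Existence of a largest matching by exhaustive search

anyVec? : ∀ {k p} {n : ℕ} {P : Pred (Vec (Fin n) k) p} → Decidable P → Dec (∃ P)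
anyVec? {zero}  P? = map′ ([] ,_) (λ { ([] , p) → p }) (P? [])
anyVec? {suc k} P? = map′ (λ (x , xs , p) → x ∷ xs , p) (λ { (x ∷ xs , p) → x , xs , p })
                      (Finₚ.any? λ x → anyVec? λ xs → P? (x ∷ xs))

module _ {m n g} {G : Fin m → Fin n → Set g} (G? : ∀ p q → Dec (G p q)) where

  private
    nonCrossing? : Decidable (NonCrossingMatching G)
    nonCrossing? M = All.all? (uncurry G?) M
      ×-dec AllPairs.allPairs? (λ (p , q) (p′ , q′) → (p Finₚ.<? p′) ×-dec (q Finₚ.<? q′)) M

    ofLength? : ∀ l → Dec (∃[ M ] (NonCrossingMatching G M × length M ≡ l))
    ofLength? l = map′ to from
      (anyVec? λ ps → anyVec? λ qs → nonCrossing? (toList (Vec.zip ps qs)))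
      where
      to : ∃[ ps ] ∃[ qs ] NonCrossingMatching G (toList (Vec.zip {n = l} ps qs)) →
           ∃[ M ] (NonCrossingMatching G M × length M ≡ l)
      to (ps , qs , M↗) = _ , M↗ , length-toList (Vec.zip ps qs)
        where
        length-toList : ∀ {a} {A : Set a} {k} (xs : Vec A k) → length (toList xs) ≡ k
        length-toList []       = refl
        length-toList (_ ∷ xs) = cong suc (length-toList xs)

      toList-zip-unzip : ∀ {a b} {A : Set a} {B : Set b} (M : List (A × B)) →
        ∃[ ps ] ∃[ qs ] (toList (Vec.zip {n = length M} ps qs) ≡ M)
      toList-zip-unzip []            = [] , [] , refl
      toList-zip-unzip ((p , q) ∷ M) with toList-zip-unzip M
      ... | ps , qs , eq = p ∷ ps , q ∷ qs , cong ((p , q) ∷_) eq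

      from : ∃[ M ] (NonCrossingMatching G M × length M ≡ l) →
             ∃[ ps ] ∃[ qs ] NonCrossingMatching G (toList (Vec.zip {n = l} ps qs))
      from (M , M↗ , refl) with toList-zip-unzip M
      ... | ps , qs , eq = ps , qs , subst (NonCrossingMatching G) (sym eq) M↗

    length≤m : ∀ M → NonCrossingMatching G M → length M ℕ.≤ m
    length≤m M (_ , M↗) = sorted-length (toℕ ∘ proj₁) (AllPairs.map proj₁ M↗)
      (All.universal (λ (p , _) → z≤n , Finₚ.toℕ<n p) M) z≤n

    -- Descends from a known bound: if length `suc l` is not attained, `l` is a bound as well. Each
    -- length is decidable, being a search over pairs of vectors of that length.
    search : ∀ l → (∀ M → NonCrossingMatching G M → length M ℕ.≤ l) →
             ∃ (LargestNonCrossingMatching G)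
    search zero    bound = [] , ([] , []) , bound
    search (suc l) bound with ofLength? (suc l)
    ... | yes (M , M↗ , eq) = M , M↗ , λ M′ M′↗ → ℕₚ.≤-trans (bound M′ M′↗) (ℕₚ.≤-reflexive (sym eq))
    ... | no ∄M = search l λ M′ M′↗ →
      ℕ.s≤s⁻¹ (ℕₚ.≤∧≢⇒< (bound M′ M′↗) (λ eq → ∄M (M′ , M′↗ , eq)))

  largest-exists : ∃ (LargestNonCrossingMatching G)
  largest-exists = search m length≤m

-- Discarding bad blocks

-- Abstracts from the two levels, blocks of length `N₁` and sub-blocks of length `N₂`. Block numbers
-- are in ℕ, so that sub-blocks can be numbered through the whole string.
record Blocking (n N : ℕ) : Set where
  field
    block    : Fin n → ℕ
    offset   : Fin n → Fin N
    position : ∀ p → toℕ p ≡ block p ℕ.* N ℕ.+ toℕ (offset p)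

  block*N≤ : ∀ p → block p ℕ.* N ℕ.≤ toℕ p
  block*N≤ p = subst (block p ℕ.* N ℕ.≤_) (sym (position p)) (ℕₚ.m≤m+n _ _)

  <block*N+N : ∀ p → toℕ p ℕ.< block p ℕ.* N ℕ.+ N
  <block*N+N p = subst (ℕ._< block p ℕ.* N ℕ.+ N) (sym (position p))
    (ℕₚ.+-monoʳ-< (block p ℕ.* N) (Finₚ.toℕ<n (offset p)))

  block-cancel-< : ∀ {p q} → block p ℕ.< block q → p Fin.< q
  block-cancel-< {p} {q} p<q = begin-strict
    toℕ p                   <⟨ <block*N+N p ⟩
    block p ℕ.* N ℕ.+ N     ≡⟨ ℕₚ.+-comm (block p ℕ.* N) N ⟩
    suc (block p) ℕ.* N     ≤⟨ ℕₚ.*-monoˡ-≤ N p<q ⟩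
    block q ℕ.* N           ≤⟨ block*N≤ q ⟩
    toℕ q                   ∎
    where open ℕₚ.≤-Reasoning

  offset-mono-< : ∀ {p q} → block p ≡ block q → p Fin.< q → offset p Fin.< offset q
  offset-mono-< {p} {q} eq p<q = ℕₚ.+-cancelˡ-< (block p ℕ.* N) _ _
    (subst₂ ℕ._<_ (position p) (trans (position q) (cong (λ k → k ℕ.* N ℕ.+ toℕ (offset q)) (sym eq))) p<q)

module _ {a p r} {A : Set a} {P : Pred A p} (P? : Decidable P) {R : Pred A r} (R? : Decidable R) where

  length-filter-filter : ∀ xs → length (filter P? (filter R? xs)) ℕ.≤ length (filter P? xs)
  length-filter-filter [] = z≤n
  length-filter-filter (x ∷ xs) with R? x
  ... | no _ with P? x
  ...   | yes _ = ℕₚ.m≤n⇒m≤1+n (length-filter-filter xs)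
  ...   | no _  = length-filter-filter xs
  length-filter-filter (x ∷ xs) | yes _ with P? x
  ...   | yes _ = s≤s (length-filter-filter xs)
  ...   | no _  = length-filter-filter xs

module _ {a p r t} {A : Set a} {P : Pred A p} {R : Pred A r} {T : Pred A t}
         (P? : Decidable P) (R? : Decidable R) (T? : Decidable T)
         (split : ∀ {x} → P x → R x ⊎ T x) (R⇒P : ∀ {x} → R x → P x) (T⇒P : ∀ {x} → T x → P x)
         (disjoint : ∀ {x} → R x → ¬ T x) where

  length-filter-⊎ : ∀ xs → length (filter P? xs) ≡ length (filter R? xs) ℕ.+ length (filter T? xs)
  length-filter-⊎ [] = refl
  length-filter-⊎ (x ∷ xs) with ih ← length-filter-⊎ xs with P? x | R? x | T? x
  ... | _      | yes rx | yes tx = contradiction tx (disjoint rx)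
  ... | yes _  | yes _  | no _   = cong suc ih
  ... | yes _  | no _   | yes _  = trans (cong suc ih) (sym (ℕₚ.+-suc _ _))
  ... | yes px | no ¬rx | no ¬tx = contradiction (split px) Sum.[ ¬rx , ¬tx ]
  ... | no ¬px | yes rx | no _   = contradiction (R⇒P rx) ¬px
  ... | no ¬px | no _   | yes tx = contradiction (T⇒P tx) ¬px
  ... | no _   | no _   | no _   = ih

length-filter-<suc : ∀ {a} {A : Set a} (f : A → ℕ) i xs →
  length (filter (λ x → f x ℕ.<? suc i) xs)
    ≡ length (filter (λ x → f x ℕ.<? i) xs) ℕ.+ length (filter (λ x → f x ℕ.≟ i) xs)
length-filter-<suc f i = length-filter-⊎ (λ x → f x ℕ.<? suc i) (λ x → f x ℕ.<? i) (λ x → f x ℕ.≟ i)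
  (ℕₚ.m<1+n⇒m<n∨m≡n) ℕₚ.m<n⇒m<1+n (s≤s ∘ ℕₚ.≤-reflexive) ℕₚ.<⇒≢

module _ {a} {A : Set a} (f : A → ℕ) where

  -- An exclusive upper end, 0 for the empty list: consecutive cuts bound half-open intervals, and
  -- the first cut is at 0.
  ceiling : List A → ℕ
  ceiling = List.foldr (λ x h → suc (f x) ℕ.⊔ h) 0

  <ceiling : ∀ {x xs} → x ∈ xs → f x ℕ.< ceiling xs
  <ceiling {x} {_ ∷ xs} (here refl) = ℕₚ.m≤m⊔n (suc (f x)) (ceiling xs)
  <ceiling {x} {y ∷ xs} (there x∈)  = ℕₚ.≤-trans (<ceiling x∈) (ℕₚ.m≤n⊔m (suc (f y)) (ceiling xs))

  ceiling≤ : ∀ {h} xs → (∀ {x} → x ∈ xs → f x ℕ.< h) → ceiling xs ℕ.≤ h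
  ceiling≤ []       _  = z≤n
  ceiling≤ (x ∷ xs) <h = ℕₚ.⊔-lub (<h (here refl)) (ceiling≤ xs (<h ∘ there))

AllPairs-mapWith : ∀ {a p r t} {A : Set a} {P : Pred A p} {R : Rel A r} {T : Rel A t} {xs} → All P xs →
  (∀ {x y} → P x → P y → R x y → T x y) → AllPairs R xs → AllPairs T xs
AllPairs-mapWith []         f []           = []
AllPairs-mapWith (px ∷ pxs) f (rx ∷ xs↗) =
  All.zipWith (λ (py , rxy) → f px py rxy) (pxs , rx) ∷ AllPairs-mapWith pxs f xs↗

comparable : ∀ {m n} {M : List (Fin m × Fin n)} → AllPairs Precedes M →
             ∀ {e f} → e ∈ M → f ∈ M → Precedes e f ⊎ e ≡ f ⊎ Precedes f e
comparable (_  ∷ _)  (here refl) (here refl) = inj₂ (inj₁ refl)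
comparable (e≺ ∷ _)  (here refl) (there f∈)  = inj₁ (All.lookup e≺ f∈)
comparable (f≺ ∷ _)  (there e∈)  (here refl) = inj₂ (inj₂ (All.lookup f≺ e∈))
comparable (_  ∷ M↗) (there e∈)  (there f∈)  = comparable M↗ e∈ f∈

-- Costs of blocks and the loss caused by pruning

module Pruning {c ℓ₁ ℓ₂} (F : OrderedField c ℓ₁ ℓ₂) (ε : OrderedField.Carrier F)
  (0<ε : OrderedField._<_ F (OrderedField.0# F) ε)
  (ε<1/121 : OrderedField._<_ F ε (OrderedField._⁻¹ F (OrderedField.fromℕ F 121))) where

  open Scaled F ε 0<ε ε<1/121

  -- Treats the values `lo`, `lo + 1`, ... one at a time. Either one of them is dense, or each of
  -- the `t` values contributes a share `≼ N` and the shares add up.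
  pigeonhole : ∀ {a} {A : Set a} (f : A → ℕ) {lo} N {xs} → All (λ x → lo ℕ.≤ f x) xs → ∀ t →
    ∃[ j ] Dense (length (filter (λ x → f x ℕ.≟ j) xs)) N
    ⊎ length (filter (λ x → f x ℕ.<? lo ℕ.+ t) xs) ≼ t ℕ.* N
  pigeonhole f {lo} N {xs} lo≤ zero = inj₂ (subst (λ ys → length ys ≼ 0)
    (sym (Listₚ.filter-none _ (All.map (λ lo≤fx → ℕₚ.≤⇒≯ (ℕₚ.≤-trans (ℕₚ.≤-reflexive (ℕₚ.+-identityʳ lo)) lo≤fx)) lo≤)))
    (0≼ 0))
  pigeonhole f {lo} N {xs} lo≤ (suc t)
    with pigeonhole f N lo≤ t | dense-or-≼ (length (filter (λ x → f x ℕ.≟ lo ℕ.+ t) xs)) N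
  ... | inj₁ dense | _          = inj₁ dense
  ... | inj₂ _     | inj₁ dense = inj₁ (_ , dense)
  ... | inj₂ ih    | inj₂ sparse
    rewrite ℕₚ.+-suc lo t | length-filter-<suc f (lo ℕ.+ t) xs | ℕₚ.+-comm N (t ℕ.* N) = inj₂ (≼-+ ih sparse)

  module Prune {m n N b : ℕ} (X : Blocking m N) (Y : Blocking n N)
           (Y<b : ∀ q → Blocking.block Y q ℕ.< b) (b*N≡n : b ℕ.* N ≡ n)
           {M : List (Fin m × Fin n)} (M↗ : AllPairs Precedes M) where

    private
      module X = Blocking X
      module Y = Blocking Y

    source target left : Fin m × Fin n → ℕ
    source = X.block ∘ proj₁
    target = Y.block ∘ proj₂
    left   = toℕ ∘ proj₁

    edgesInto : ℕ → List (Fin m × Fin n)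
    edgesInto i = filter (λ e → target e ℕ.≟ i) M

    private
      edgesBefore : ℕ → List (Fin m × Fin n)
      edgesBefore i = filter (λ e → target e ℕ.<? i) M

      -- The part of S aligned with S′(i) consists of the positions from cut i up to,
      -- but excluding, cut (suc i).
      cut : ℕ → ℕ
      cut i = ceiling left (edgesBefore i)

      -- The order of the targets rules out two of the three cases of `comparable`. Hence distinct
      -- blocks of S′ are aligned with disjoint parts of S.
      target-<⇒left-< : ∀ {e f} → e ∈ M → f ∈ M → target e ℕ.< target f → left e ℕ.< left f
      target-<⇒left-< e∈ f∈ lt with comparable M↗ e∈ f∈
      ... | inj₁ (p< , _)         = p<
      ... | inj₂ (inj₁ refl)      = contradiction refl (ℕₚ.<⇒≢ lt)
      ... | inj₂ (inj₂ (_ , q<))  = contradiction (Y.block-cancel-< lt) (ℕₚ.<-asym q<)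

      ∈-edgesInto⁻ : ∀ {i e} → e ∈ edgesInto i → e ∈ M × target e ≡ i
      ∈-edgesInto⁻ {i} = ∈ₚ.∈-filter⁻ (λ e → target e ℕ.≟ i) {xs = M}

      ∈-edgesInto⁺ : ∀ {i e} → e ∈ M → target e ≡ i → e ∈ edgesInto i
      ∈-edgesInto⁺ {i} = ∈ₚ.∈-filter⁺ (λ e → target e ℕ.≟ i)

      ∈-edgesBefore⁻ : ∀ {i e} → e ∈ edgesBefore i → e ∈ M × target e ℕ.< i
      ∈-edgesBefore⁻ {i} = ∈ₚ.∈-filter⁻ (λ e → target e ℕ.<? i) {xs = M}

      cut≤ : ∀ {i e} → e ∈ edgesInto i → cut i ℕ.≤ left e
      cut≤ {i} e∈ with e∈M , refl ← ∈-edgesInto⁻ e∈ = ceiling≤ left (edgesBefore i) λ f∈ →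
        let f∈M , f<i = ∈-edgesBefore⁻ f∈ in target-<⇒left-< f∈M e∈M f<i

      <cut : ∀ {i e} → e ∈ edgesInto i → left e ℕ.< cut (suc i)
      <cut {i} e∈ with e∈M , refl ← ∈-edgesInto⁻ e∈ =
        <ceiling left (∈ₚ.∈-filter⁺ (λ e → target e ℕ.<? suc i) {xs = M} e∈M ℕₚ.≤-refl)

      cut-mono : ∀ i → cut i ℕ.≤ cut (suc i)
      cut-mono i = ceiling≤ left (edgesBefore i) λ f∈ →
        let f∈M , f<i = ∈-edgesBefore⁻ f∈
        in <ceiling left (∈ₚ.∈-filter⁺ (λ e → target e ℕ.<? suc i) {xs = M} f∈M (ℕₚ.m<n⇒m<1+n f<i))

      edgesInto↗ : ∀ i → AllPairs Precedes (edgesInto i)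
      edgesInto↗ i = AllPairsₚ.filter⁺ (λ e → target e ℕ.≟ i) M↗

      load : ℕ → ℕ
      load i = length (edgesInto i)

      cut+load≤ : ∀ i → cut i ℕ.+ load i ℕ.≤ cut (suc i)
      cut+load≤ i = sorted-length left (AllPairs.map proj₁ (edgesInto↗ i))
        (All.tabulate λ e∈ → cut≤ e∈ , <cut e∈) (cut-mono i)

      load≤N : ∀ i → load i ℕ.≤ N
      load≤N i = ℕₚ.+-cancelˡ-≤ (i ℕ.* N) _ _
        (sorted-length (toℕ ∘ proj₂) (AllPairs.map proj₂ (edgesInto↗ i))
          (All.tabulate λ e∈ → inBlock (∈-edgesInto⁻ e∈)) (ℕₚ.m≤m+n (i ℕ.* N) N))
        where
        inBlock : ∀ {e} → e ∈ M × target e ≡ i →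
                  i ℕ.* N ℕ.≤ toℕ (proj₂ e) × toℕ (proj₂ e) ℕ.< i ℕ.* N ℕ.+ N
        inBlock {_ , q} (_ , refl) = Y.block*N≤ q , Y.<block*N+N q

      -- The truncated subtractions are exact by `cut+load≤` and `load≤N`; `cut-suc` and `N≡`
      -- restate them additively.
      unmatchedX unmatchedY cost : ℕ → ℕ
      unmatchedX i = cut (suc i) ℕ.∸ (cut i ℕ.+ load i)
      unmatchedY i = N ℕ.∸ load i
      cost i = unmatchedX i ℕ.+ unmatchedY i

      cut-suc : ∀ i → cut (suc i) ≡ unmatchedX i ℕ.+ (cut i ℕ.+ load i)
      cut-suc i = sym (ℕₚ.m∸n+n≡m (cut+load≤ i))

      N≡ : ∀ i → N ≡ unmatchedY i ℕ.+ load i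
      N≡ i = sym (ℕₚ.m∸n+n≡m (load≤N i))

    -- The dense block of S is named by an edge in it: its left endpoint supplies the index of a
    -- codeword, which a bare block number in ℕ would not. `near` concerns all edges into the block,
    -- not only those from the dense one.
    record Good (i : ℕ) : Set ℓ₂ where
      field
        witness   : Fin m × Fin n
        witness∈M : witness ∈ M
        target≡   : target witness ≡ i
        dense     : Dense (length (filter (λ e → source e ℕ.≟ source witness) (edgesInto i))) N
        near      : ∀ {e} → e ∈ M → target e ≡ i → source e ∈±w source witness

    private
      Costly : ℕ → Set ℓ₂
      Costly i = load i ≼ 3 ℕ.* cost i

      -- The blocks strictly between the outermost two lie between `cut i` and `cut (suc i)`, where
      -- there are `load i + unmatchedX i` symbols. The outermost two may stick out, which costs
      -- `2 * N`.
      spread : ∀ i {e es} → edgesInto i ≡ e ∷ es →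
        ∃[ lo ] ∃[ u ] (All (λ f → lo ℕ.≤ source f × source f ℕ.≤ lo ℕ.+ u) (edgesInto i)
          × suc u ℕ.* N ℕ.≤ 2 ℕ.* N ℕ.+ load i ℕ.+ unmatchedX i)
      spread i {e} {es} eq = lo , u
        , subst (All _) (sym eq) (All.zip
            ( (Extrema.f[argmin]≤f[⊤] {f = source} e es ∷ Extrema.f[argmin]≤f[xs] e es)
            , subst (λ z → All (λ f → source f ℕ.≤ z) (e ∷ es)) (sym (ℕₚ.m+[n∸m]≡n lo≤hi))
                (Extrema.f[⊥]≤f[argmax] {f = source} e es ∷ Extrema.f[xs]≤f[argmax] e es)))
        , ℕₚ.+-cancelˡ-≤ (lo ℕ.* N) _ _ (begin
            lo ℕ.* N ℕ.+ suc u ℕ.* N              ≡⟨ arith₁ lo u N ⟩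
            (lo ℕ.+ u) ℕ.* N ℕ.+ N                ≡⟨ cong (λ z → z ℕ.* N ℕ.+ N) (ℕₚ.m+[n∸m]≡n lo≤hi) ⟩
            source last ℕ.* N ℕ.+ N               ≤⟨ ℕₚ.+-monoˡ-≤ N (X.block*N≤ (proj₁ last)) ⟩
            left last ℕ.+ N                       ≤⟨ ℕₚ.+-monoˡ-≤ N (ℕₚ.<⇒≤ (<cut last∈)) ⟩
            cut (suc i) ℕ.+ N                     ≡⟨ cong (ℕ._+ N) (cut-suc i) ⟩
            unmatchedX i ℕ.+ (cut i ℕ.+ load i) ℕ.+ N
              ≤⟨ ℕₚ.+-monoˡ-≤ N (ℕₚ.+-monoʳ-≤ (unmatchedX i) (ℕₚ.+-monoˡ-≤ (load i)
                   (ℕₚ.≤-trans (cut≤ first∈) (ℕₚ.<⇒≤ (X.<block*N+N (proj₁ first)))))) ⟩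
            unmatchedX i ℕ.+ (lo ℕ.* N ℕ.+ N ℕ.+ load i) ℕ.+ N
              ≡⟨ arith₂ (unmatchedX i) (lo ℕ.* N) N (load i) ⟩
            lo ℕ.* N ℕ.+ (2 ℕ.* N ℕ.+ load i ℕ.+ unmatchedX i) ∎)
        where
        open ℕₚ.≤-Reasoning
        first = Extrema.argmin source e es
        last  = Extrema.argmax source e es
        lo    = source first
        u     = source last ℕ.∸ lo

        all∈ : All (_∈ edgesInto i) (e ∷ es)
        all∈ = subst (λ fs → All (_∈ fs) (e ∷ es)) (sym eq) (All.tabulate id)

        first∈ : first ∈ edgesInto i
        first∈ = Extrema.argmin-all source (All.head all∈) (All.tail all∈)

        last∈ : last ∈ edgesInto i
        last∈ = Extrema.argmax-all source (All.head all∈) (All.tail all∈)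

        lo≤hi : lo ℕ.≤ source last
        lo≤hi = ℕₚ.≤-trans (Extrema.f[argmin]≤f[⊤] {f = source} e es) (Extrema.f[⊥]≤f[argmax] {f = source} e es)

        arith₁ : ∀ l u N → l ℕ.* N ℕ.+ suc u ℕ.* N ≡ (l ℕ.+ u) ℕ.* N ℕ.+ N
        arith₁ = solve-∀
        arith₂ : ∀ x l N s → x ℕ.+ (l ℕ.+ N ℕ.+ s) ℕ.+ N ≡ l ℕ.+ (2 ℕ.* N ℕ.+ s ℕ.+ x)
        arith₂ = solve-∀

      -- Scaling `1 ≼ t` by `N` gives 121 N ≤ N t ≤ 3 N + x, so x outweighs 3 N and N t ≤ 2 x. The
      -- load is at most `N`, and `N ≼ N * t`.
      scattered⇒costly : ∀ i t → t ℕ.* N ℕ.≤ 2 ℕ.* N ℕ.+ load i ℕ.+ unmatchedX i → 1 ≼ t → Costly i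
      scattered⇒costly i t t*N≤ 1≼t = ≼-monoˡ (load≤N i) (≼-monoʳ N*t≤ N≼N*t)
        where
        open ℕₚ.≤-Reasoning
        x = unmatchedX i
        N≼N*t : N ≼ N ℕ.* t
        N≼N*t = subst (_≼ N ℕ.* t) (ℕₚ.*-identityʳ N) (≼-* N 1≼t)
        N*t≤3N+x : N ℕ.* t ℕ.≤ 3 ℕ.* N ℕ.+ x
        N*t≤3N+x = begin
          N ℕ.* t                     ≡⟨ ℕₚ.*-comm N t ⟩
          t ℕ.* N                     ≤⟨ t*N≤ ⟩
          2 ℕ.* N ℕ.+ load i ℕ.+ x    ≤⟨ ℕₚ.+-monoˡ-≤ x (ℕₚ.+-monoʳ-≤ (2 ℕ.* N) (load≤N i)) ⟩
          2 ℕ.* N ℕ.+ N ℕ.+ x         ≡⟨ cong (ℕ._+ x) (ℕₚ.+-comm (2 ℕ.* N) N) ⟩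
          3 ℕ.* N ℕ.+ x               ∎
        3N≤x : 3 ℕ.* N ℕ.≤ x
        3N≤x = ℕₚ.+-cancelˡ-≤ (3 ℕ.* N) _ _ (begin
          3 ℕ.* N ℕ.+ 3 ℕ.* N   ≡⟨ ℕₚ.*-distribʳ-+ N 3 3 ⟨
          6 ℕ.* N               ≤⟨ ℕₚ.*-monoˡ-≤ N (ℕₚ.m≤m+n 6 115) ⟩
          121 ℕ.* N             ≤⟨ ≼⇒121*≤ N≼N*t ⟩
          N ℕ.* t               ≤⟨ N*t≤3N+x ⟩
          3 ℕ.* N ℕ.+ x         ∎)
        N*t≤ : N ℕ.* t ℕ.≤ 3 ℕ.* cost i
        N*t≤ = begin
          N ℕ.* t           ≤⟨ N*t≤3N+x ⟩
          3 ℕ.* N ℕ.+ x     ≤⟨ ℕₚ.+-monoˡ-≤ x 3N≤x ⟩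
          x ℕ.+ x           ≤⟨ ℕₚ.+-monoʳ-≤ x (ℕₚ.m≤m+n x (x ℕ.+ 0)) ⟩
          3 ℕ.* x           ≤⟨ ℕₚ.*-monoʳ-≤ 3 (ℕₚ.m≤m+n x (unmatchedY i)) ⟩
          3 ℕ.* cost i      ∎

      -- Substituting N = y + l bounds t N by 3 l + 2 cost. As 121 l ≤ t N, the term 3 l is itself
      -- at most the cost.
      sparse⇒costly : ∀ i t → t ℕ.* N ℕ.≤ 2 ℕ.* N ℕ.+ load i ℕ.+ unmatchedX i → load i ≼ t ℕ.* N → Costly i
      sparse⇒costly i t t*N≤ sparse = ≼-monoʳ (begin
          t ℕ.* N                       ≤⟨ t*N≤3l+2c ⟩
          3 ℕ.* l ℕ.+ 2 ℕ.* cost i      ≤⟨ ℕₚ.+-monoˡ-≤ (2 ℕ.* cost i) 3l≤c ⟩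
          3 ℕ.* cost i                  ∎) sparse
        where
        open ℕₚ.≤-Reasoning
        l = load i
        arith₁ : ∀ x y l → 2 ℕ.* (y ℕ.+ l) ℕ.+ l ℕ.+ x ℕ.+ x ≡ 3 ℕ.* l ℕ.+ 2 ℕ.* (x ℕ.+ y)
        arith₁ = solve-∀
        arith₂ : ∀ l → 3 ℕ.* l ℕ.+ 2 ℕ.* (3 ℕ.* l) ≡ 9 ℕ.* l
        arith₂ = solve-∀
        t*N≤3l+2c : t ℕ.* N ℕ.≤ 3 ℕ.* l ℕ.+ 2 ℕ.* cost i
        t*N≤3l+2c = begin
          t ℕ.* N                                           ≤⟨ t*N≤ ⟩
          2 ℕ.* N ℕ.+ l ℕ.+ unmatchedX i                    ≤⟨ ℕₚ.m≤m+n _ (unmatchedX i) ⟩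
          2 ℕ.* N ℕ.+ l ℕ.+ unmatchedX i ℕ.+ unmatchedX i
            ≡⟨ cong (λ z → 2 ℕ.* z ℕ.+ l ℕ.+ unmatchedX i ℕ.+ unmatchedX i) (N≡ i) ⟩
          2 ℕ.* (unmatchedY i ℕ.+ l) ℕ.+ l ℕ.+ unmatchedX i ℕ.+ unmatchedX i
            ≡⟨ arith₁ (unmatchedX i) (unmatchedY i) l ⟩
          3 ℕ.* l ℕ.+ 2 ℕ.* cost i                          ∎
        3l≤c : 3 ℕ.* l ℕ.≤ cost i
        3l≤c = ℕₚ.*-cancelˡ-≤ 2 (ℕₚ.+-cancelˡ-≤ (3 ℕ.* l) _ _ (begin
          3 ℕ.* l ℕ.+ 2 ℕ.* (3 ℕ.* l)   ≡⟨ arith₂ l ⟩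
          9 ℕ.* l                       ≤⟨ ℕₚ.*-monoˡ-≤ l (ℕₚ.m≤m+n 9 112) ⟩
          121 ℕ.* l                     ≤⟨ ≼⇒121*≤ sparse ⟩
          t ℕ.* N                       ≤⟨ t*N≤3l+2c ⟩
          3 ℕ.* l ℕ.+ 2 ℕ.* cost i      ∎))

      nonempty⇒∃∈ : ∀ {a} {A : Set a} {xs : List A} → 0 ℕ.< length xs → ∃[ x ] x ∈ xs
      nonempty⇒∃∈ {xs = x ∷ _} _ = x , here refl

      empty-or-∷ : ∀ {a} {A : Set a} (xs : List A) → xs ≡ [] ⊎ ∃[ y ] ∃[ ys ] xs ≡ y ∷ ys
      empty-or-∷ []      = inj₁ refl
      empty-or-∷ (_ ∷ _) = inj₂ (_ , _ , refl)

      good-or-costly : ∀ i → Good i ⊎ Costly i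
      good-or-costly i with empty-or-∷ (edgesInto i)
      ... | inj₁ eq = inj₂ (subst (λ es → length es ≼ 3 ℕ.* cost i) (sym eq) (0≼ (3 ℕ.* cost i)))
      ... | inj₂ (_ , _ , eq) with lo , u , bounds , t*N≤ ← spread i eq with ≤w-or-1≼ (suc u)
      ...   | inj₂ 1≼t = inj₂ (scattered⇒costly i (suc u) t*N≤ 1≼t)
      ...   | inj₁ t≤w with pigeonhole source N (All.map proj₁ bounds) (suc u)
      ...     | inj₂ sparse = inj₂ (sparse⇒costly i (suc u) t*N≤ (subst (λ es → length es ≼ suc u ℕ.* N)
                  (Listₚ.filter-all _ (All.map (λ {f} (_ , ≤hi) → subst (source f ℕ.<_) (sym (ℕₚ.+-suc lo u)) (s≤s ≤hi)) bounds))
                  sparse))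
      ...     | inj₁ (j , dense) with nonempty⇒∃∈ (dense⇒>0 0<N dense)
        where
        -- For `N = 0` even an empty list is dense; the edge at hand excludes this.
        0<N : 0 ℕ.< N
        0<N = ℕₚ.<-≤-trans (subst (λ es → 0 ℕ.< length es) (sym eq) ℕ.z<s) (load≤N i)
      ...       | e , e∈ with e∈i , refl ← ∈ₚ.∈-filter⁻ (λ e → source e ℕ.≟ j) {xs = edgesInto i} e∈ = inj₁ record
                  { witness   = e
                  ; witness∈M = proj₁ (∈-edgesInto⁻ e∈i)
                  ; target≡   = proj₂ (∈-edgesInto⁻ e∈i)
                  ; dense     = dense
                  ; near      = λ f∈M f≡i →
                      let lo≤f , f≤ = All.lookup bounds (∈-edgesInto⁺ f∈M f≡i)
                          lo≤e , e≤ = All.lookup bounds e∈i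
                      in within-t⇒∈±w t≤w (reach f≤ lo≤e) (reach e≤ lo≤f)
                  }
        where
        -- Sources differ by at most `u`; this is weakened to `suc u`, the number of blocks that was
        -- compared with w.
        reach : ∀ {x y} → x ℕ.≤ lo ℕ.+ u → lo ℕ.≤ y → x ℕ.≤ y ℕ.+ suc u
        reach x≤ lo≤y = ℕₚ.≤-trans x≤ (ℕₚ.+-mono-≤ lo≤y (ℕₚ.n≤1+n u))

      costly? : ∀ i → Dec (Costly i)
      costly? i = _ ≼? _

    -- Defined by `Costly` rather than by failure of `Good`: this is the condition that can be
    -- charged to the cost, and `≼` is decidable.
    Bad : Fin m × Fin n → Set ℓ₂
    Bad e = Costly (target e)

    bad? : Decidable Bad
    bad? e = costly? (target e)

    ¬bad⇒good : ∀ {e} → ¬ Bad e → Good (target e)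
    ¬bad⇒good {e} ¬bad with good-or-costly (target e)
    ... | inj₁ good   = good
    ... | inj₂ costly = contradiction costly ¬bad

    private
      badEdges : List (Fin m × Fin n)
      badEdges = filter bad? M

      -- Badness depends on the target block only, so the edges into block `i` are all bad or all
      -- retained.
      badInto : ∀ i → length (filter (λ e → target e ℕ.≟ i) badEdges) ≼ 3 ℕ.* cost i
      badInto i with costly? i
      ... | yes costly = ≼-monoˡ (length-filter-filter (λ e → target e ℕ.≟ i) bad? M) costly
      ... | no ¬costly = subst (λ es → length es ≼ 3 ℕ.* cost i)
        (sym (Listₚ.filter-none _ (All.map (λ { bad refl → ¬costly bad }) (Allₚ.all-filter bad? M))))
        (0≼ (3 ℕ.* cost i))

      -- Here `d` is the sum of the first `i` costs. The equation says that it counts exactly the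
      -- unmatched symbols of S before `cut i` and of the first `i` blocks of S′.
      accumulate : ∀ i → ∃[ d ] (d ℕ.+ 2 ℕ.* length (edgesBefore i) ≡ cut i ℕ.+ i ℕ.* N
                            × length (filter (λ e → target e ℕ.<? i) badEdges) ≼ 3 ℕ.* d)
      accumulate zero
        rewrite Listₚ.filter-none (λ e → target e ℕ.<? 0) (All.universal (λ _ ()) M)
              | Listₚ.filter-none (λ e → target e ℕ.<? 0) (All.universal (λ _ ()) badEdges) =
        0 , refl , 0≼ 0
      accumulate (suc i) with d , eq , bad≼ ← accumulate i =
          d ℕ.+ cost i
        , (begin
            d ℕ.+ (x ℕ.+ y) ℕ.+ 2 ℕ.* length (edgesBefore (suc i))
              ≡⟨ cong (λ z → d ℕ.+ (x ℕ.+ y) ℕ.+ 2 ℕ.* z) (length-filter-<suc target i M) ⟩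
            d ℕ.+ (x ℕ.+ y) ℕ.+ 2 ℕ.* (length (edgesBefore i) ℕ.+ s)
              ≡⟨ arith₁ d x y (length (edgesBefore i)) s ⟩
            (d ℕ.+ 2 ℕ.* length (edgesBefore i)) ℕ.+ (x ℕ.+ y ℕ.+ 2 ℕ.* s)
              ≡⟨ cong (ℕ._+ (x ℕ.+ y ℕ.+ 2 ℕ.* s)) eq ⟩
            cut i ℕ.+ i ℕ.* N ℕ.+ (x ℕ.+ y ℕ.+ 2 ℕ.* s)
              ≡⟨ arith₂ (cut i) (i ℕ.* N) x y s ⟩
            (x ℕ.+ (cut i ℕ.+ s)) ℕ.+ ((y ℕ.+ s) ℕ.+ i ℕ.* N)
              ≡⟨ cong₂ (λ c N′ → c ℕ.+ (N′ ℕ.+ i ℕ.* N)) (sym (cut-suc i)) (sym (N≡ i)) ⟩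
            cut (suc i) ℕ.+ (N ℕ.+ i ℕ.* N) ∎)
        , subst₂ _≼_ (sym (length-filter-<suc target i badEdges)) (sym (ℕₚ.*-distribˡ-+ 3 d (cost i)))
            (≼-+ bad≼ (badInto i))
        where
        open ≡-Reasoning
        x = unmatchedX i
        y = unmatchedY i
        s = load i
        arith₁ : ∀ d x y l s → d ℕ.+ (x ℕ.+ y) ℕ.+ 2 ℕ.* (l ℕ.+ s) ≡ (d ℕ.+ 2 ℕ.* l) ℕ.+ (x ℕ.+ y ℕ.+ 2 ℕ.* s)
        arith₁ = solve-∀
        arith₂ : ∀ c iN x y s → c ℕ.+ iN ℕ.+ (x ℕ.+ y ℕ.+ 2 ℕ.* s) ≡ (x ℕ.+ (c ℕ.+ s)) ℕ.+ ((y ℕ.+ s) ℕ.+ iN)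
        arith₂ = solve-∀

    bad≼3d : ∀ {d} → m ℕ.+ n ℕ.≤ d ℕ.+ 2 ℕ.* length M → length (filter bad? M) ≼ 3 ℕ.* d
    bad≼3d {d} m+n≤ with d₀ , eq , bad≼ ← accumulate b =
      ≼-monoʳ (ℕₚ.*-monoʳ-≤ 3 d₀≤d)
        (subst (λ es → length es ≼ 3 ℕ.* d₀)
          (Listₚ.filter-all _ (All.universal (λ e → Y<b (proj₂ e)) badEdges)) bad≼)
      where
      open ℕₚ.≤-Reasoning
      d₀≤d : d₀ ℕ.≤ d
      d₀≤d = ℕₚ.+-cancelʳ-≤ (2 ℕ.* length M) _ _ (begin
        d₀ ℕ.+ 2 ℕ.* length M
          ≡⟨ cong (λ es → d₀ ℕ.+ 2 ℕ.* length es) (Listₚ.filter-all _ (All.universal (λ e → Y<b (proj₂ e)) M)) ⟨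
        d₀ ℕ.+ 2 ℕ.* length (edgesBefore b)   ≡⟨ eq ⟩
        -- Symbols of S from the last cut on are unmatched and charged to no block, hence only an
        -- inequality.
        cut b ℕ.+ b ℕ.* N                     ≤⟨ ℕₚ.+-mono-≤ (ceiling≤ left (edgesBefore b) (λ {e} _ → Finₚ.toℕ<n (proj₁ e))) (ℕₚ.≤-reflexive b*N≡n) ⟩
        m ℕ.+ n                               ≤⟨ m+n≤ ⟩
        d ℕ.+ 2 ℕ.* length M                  ∎)

    module _ {i : ℕ} (good : Good i) {q} {x y : Vec (Fin q) N}
             (same : ∀ {e} → e ∈ M → source e ≡ source (Good.witness good) → target e ≡ i →
                     Same x y (X.offset (proj₁ e)) (Y.offset (proj₂ e))) where

      private
        heavy : List (Fin m × Fin n)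
        heavy = filter (λ e → source e ℕ.≟ source (Good.witness good)) (edgesInto i)

        heavy-spec : ∀ {e} → e ∈ heavy → e ∈ M × source e ≡ source (Good.witness good) × target e ≡ i
        heavy-spec e∈ =
          let e∈i , s≡ = ∈ₚ.∈-filter⁻ (λ e → source e ℕ.≟ source (Good.witness good)) {xs = edgesInto i} e∈
              e∈M , t≡ = ∈-edgesInto⁻ e∈i
          in e∈M , s≡ , t≡

        localised : List (Fin N × Fin N)
        localised = List.map (Product.map X.offset Y.offset) heavy

        localised↗ : NonCrossingMatching (Same x y) localised
        localised↗ =
            Allₚ.map⁺ (All.tabulate (λ e∈ → let e∈M , s≡ , t≡ = heavy-spec e∈ in same e∈M s≡ t≡))
          , AllPairsₚ.map⁺ (AllPairs-mapWith (All.tabulate heavy-spec)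
              (λ (_ , s≡ , t≡) (_ , s≡′ , t≡′) (p< , q<) →
                X.offset-mono-< (trans s≡ (sym s≡′)) p< , Y.offset-mono-< (trans t≡ (sym t≡′)) q<)
              (AllPairsₚ.filter⁺ (λ e → source e ℕ.≟ source (Good.witness good)) (edgesInto↗ i)))

        localised-dense : Dense (length localised) N
        localised-dense = subst (λ l → Dense l N) (sym (Listₚ.length-map _ heavy)) (Good.dense good)

      -- Read relative to their two blocks, the edges of the dense pair form a non-crossing matching
      -- of two words of length `N`. Its operations delete and insert at most the permitted number
      -- of symbols.
      good⇒corrupts : Corrupts F ε N (toList x) (toList y)
      good⇒corrupts = operations x y localised
        , operations-correct x y localised↗
        , dense⇒corruption localised-dense (#deletions-operations x y localised↗)
        , dense⇒corruption localised-dense (#insertions-operations x y localised↗)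

-- The algorithm

quotient-blocking : ∀ k N → Blocking (k ℕ.* N) N
quotient-blocking k N = record
  { block    = toℕ ∘ Fin.quotient {k} N
  ; offset   = Fin.remainder {k} N
  ; position = λ p → begin
      toℕ p                                              ≡⟨ cong toℕ (Finₚ.combine-remQuot {k} N p) ⟨
      toℕ (uncurry combine (remQuot {k} N p))            ≡⟨ uncurry Finₚ.toℕ-combine (remQuot {k} N p) ⟩
      N ℕ.* toℕ (Fin.quotient {k} N p) ℕ.+ toℕ (Fin.remainder {k} N p)
        ≡⟨ cong (ℕ._+ toℕ (Fin.remainder {k} N p)) (ℕₚ.*-comm N _) ⟩
      toℕ (Fin.quotient {k} N p) ℕ.* N ℕ.+ toℕ (Fin.remainder {k} N p) ∎
  }
  where open ≡-Reasoning

module Coordinates (k n N : ℕ) where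

  outer : Fin (k ℕ.* (n ℕ.* N)) → Fin k
  outer = Fin.quotient {k} (n ℕ.* N)

  offset : Fin (k ℕ.* (n ℕ.* N)) → Fin (n ℕ.* N)
  offset = Fin.remainder {k} (n ℕ.* N)

  inner : Fin (k ℕ.* (n ℕ.* N)) → Fin n
  inner = Fin.quotient {n} N ∘ offset

  suboffset : Fin (k ℕ.* (n ℕ.* N)) → Fin N
  suboffset = Fin.remainder {n} N ∘ offset

  combine-offset : ∀ p → combine (outer p) (offset p) ≡ p
  combine-offset = Finₚ.combine-remQuot {k} (n ℕ.* N)

  combine-suboffset : ∀ p → combine (inner p) (suboffset p) ≡ offset p
  combine-suboffset p = Finₚ.combine-remQuot {n} N (offset p)

  combine-coordinates : ∀ p → combine (outer p) (combine (inner p) (suboffset p)) ≡ p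
  combine-coordinates p = trans (cong (combine (outer p)) (combine-suboffset p)) (combine-offset p)

  subblock : Fin (k ℕ.* (n ℕ.* N)) → ℕ
  subblock p = toℕ (outer p) ℕ.* n ℕ.+ toℕ (inner p)

  subblock≡ : ∀ p → subblock p ≡ toℕ (combine (outer p) (inner p))
  subblock≡ p = sym (trans (Finₚ.toℕ-combine (outer p) (inner p))
                      (cong (ℕ._+ toℕ (inner p)) (ℕₚ.*-comm n (toℕ (outer p)))))

  subblock< : ∀ p → subblock p ℕ.< k ℕ.* n
  subblock< p = subst (ℕ._< k ℕ.* n) (sym (subblock≡ p)) (Finₚ.toℕ<n (combine (outer p) (inner p)))

  subblock-injective : ∀ p q → subblock p ≡ subblock q → outer p ≡ outer q × inner p ≡ inner q
  subblock-injective p q eq = Finₚ.combine-injective _ _ _ _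
    (Finₚ.toℕ-injective (trans (sym (subblock≡ p)) (trans eq (subblock≡ q))))

  subblocking : Blocking (k ℕ.* (n ℕ.* N)) N
  subblocking = record
    { block    = subblock
    ; offset   = suboffset
    ; position = λ p → begin
        toℕ p                                                    ≡⟨ Blocking.position (quotient-blocking k (n ℕ.* N)) p ⟩
        toℕ (outer p) ℕ.* (n ℕ.* N) ℕ.+ toℕ (offset p)           ≡⟨ cong (toℕ (outer p) ℕ.* (n ℕ.* N) ℕ.+_) (Blocking.position (quotient-blocking n N) (offset p)) ⟩
        toℕ (outer p) ℕ.* (n ℕ.* N) ℕ.+ (toℕ (inner p) ℕ.* N ℕ.+ toℕ (suboffset p))
          ≡⟨ arith (toℕ (outer p)) n N (toℕ (inner p)) (toℕ (suboffset p)) ⟩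
        subblock p ℕ.* N ℕ.+ toℕ (suboffset p) ∎
    }
    where
    open ≡-Reasoning
    arith : ∀ a n N b r → a ℕ.* (n ℕ.* N) ℕ.+ (b ℕ.* N ℕ.+ r) ≡ (a ℕ.* n ℕ.+ b) ℕ.* N ℕ.+ r
    arith = solve-∀

shift-origin : ∀ B s N r → + (B ℕ.* N ℕ.+ r) ≡ + (s ℕ.* N) ℤ.+ (B ⊖ s) ℤ.* + N ℤ.+ + r
shift-origin B s N r = begin
  + (B ℕ.* N) ℤ.+ + r                                    ≡⟨ cong (ℤ._+ + r) (ℤₚ.pos-* B N) ⟩
  + B ℤ.* + N ℤ.+ + r                                    ≡⟨ arith (+ B) (+ s) (+ N) (+ r) ⟩
  + s ℤ.* + N ℤ.+ (+ B ℤ.- + s) ℤ.* + N ℤ.+ + r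
    ≡⟨ cong₂ (λ x y → x ℤ.+ y ℤ.* + N ℤ.+ + r) (sym (ℤₚ.pos-* s N)) (ℤₚ.m-n≡m⊖n B s) ⟩
  + (s ℕ.* N) ℤ.+ (B ⊖ s) ℤ.* + N ℤ.+ + r                ∎
  where
  open ≡-Reasoning
  arith : ∀ B s N r → B ℤ.* N ℤ.+ r ≡ s ℤ.* N ℤ.+ (B ℤ.- s) ℤ.* N ℤ.+ r
  arith = ℤ-RingSolver.solve-∀

-- Remainders below `N` differ by less than `N`, whereas distinct quotients would contribute at
-- least `N`.
quotient-unique : ∀ {N} o {z z′ : ℤ} {r r′ : ℕ} → r ℕ.< N → r′ ℕ.< N →
  o ℤ.+ z ℤ.* + N ℤ.+ + r ≡ o ℤ.+ z′ ℤ.* + N ℤ.+ + r′ → z ≡ z′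
quotient-unique {N} o {z} {z′} {r} {r′} r<N r′<N eq =
  ℤₚ.i-j≡0⇒i≡j z z′ (ℤₚ.∣i∣≡0⇒i≡0 (small ℤ.∣ z ℤ.- z′ ∣ (begin-strict
    ℤ.∣ z ℤ.- z′ ∣ ℕ.* N               ≡⟨ ℤₚ.abs-* (z ℤ.- z′) (+ N) ⟨
    ℤ.∣ (z ℤ.- z′) ℤ.* + N ∣           ≡⟨ cong ℤ.∣_∣ difference ⟩
    ℤ.∣ r′ ⊖ r ∣                       ≤⟨ ℤₚ.∣m⊝n∣≤m⊔n r′ r ⟩
    r′ ℕ.⊔ r                           <⟨ ℕₚ.⊔-lub r′<N r<N ⟩
    N                                  ∎)))
  where
  open ℕₚ.≤-Reasoning
  small : ∀ a → a ℕ.* N ℕ.< N → a ≡ 0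
  small zero    _  = refl
  small (suc a) lt = contradiction lt (ℕₚ.≤⇒≯ (ℕₚ.m≤m+n N (a ℕ.* N)))
  arith₁ : ∀ o z z′ N r → (z ℤ.- z′) ℤ.* N ≡ (o ℤ.+ z ℤ.* N ℤ.+ r) ℤ.- (o ℤ.+ z′ ℤ.* N ℤ.+ r)
  arith₁ = ℤ-RingSolver.solve-∀
  arith₂ : ∀ x r r′ → (x ℤ.+ r′) ℤ.- (x ℤ.+ r) ≡ r′ ℤ.- r
  arith₂ = ℤ-RingSolver.solve-∀
  difference : (z ℤ.- z′) ℤ.* + N ≡ r′ ⊖ r
  difference = trans (arith₁ o z z′ (+ N) (+ r))
    (trans (cong (ℤ._- (o ℤ.+ z′ ℤ.* + N ℤ.+ + r)) eq)
      (trans (arith₂ (o ℤ.+ z′ ℤ.* + N) (+ r) (+ r′)) (ℤₚ.m-n≡m⊖n r′ r)))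

-- From good blocks to edges of `G` and the guarantee

module Analysis {c ℓ₁ ℓ₂ a} (F : OrderedField c ℓ₁ ℓ₂) (ε : OrderedField.Carrier F)
  (0<ε : OrderedField._<_ F (OrderedField.0# F) ε)
  (ε<1/121 : OrderedField._<_ F ε (OrderedField._⁻¹ F (OrderedField.fromℕ F 121)))
  {q₁ q₂ N₂ L₁ L₂ : ℕ} (C₂ : Code q₂ N₂) (C₁ : Code q₁ (N₁ C₂))
  (D₁ : ListDecoder F ε C₁ L₁) (D₂ : ListDecoder F ε C₂ L₂)
  {Γ : Set a} (_≟Γ_ : DecidableEquality Γ)
  (m : Vec Γ (|I| C₂ C₁)) (b : ℕ) (S′ : Vec (Γ × Fin q₁ × Fin q₂) (b ℕ.* N₁ C₂)) where

  open OrderedField F using (_≤_; 1#; _+_; _*_; _-_; fromℕ; fromℤ; isDecTotalOrder)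

  S : Vec (Γ × Fin q₁ × Fin q₂) (|I| C₂ C₁)
  S = indexed C₂ C₁ m

  open Enhanced-ED-Approx F ε D₁ D₂ {b = b} S S′
  open Scaled F ε 0<ε ε<1/121
  open Pruning F ε 0<ε ε<1/121
  module O = IsDecTotalOrder isDecTotalOrder
  module X = Coordinates (size C₁) (size C₂) N₂
  module Y = Coordinates b (size C₂) N₂

  -- The only possible `k′` for given `p` and `k`; negative if `p` precedes block `k`.
  displacement : Fin (|I| C₂ C₁) → Fin (size C₁) → ℤ
  displacement p k = X.subblock p ⊖ toℕ k ℕ.* size C₂

  position-in-S : ∀ p k → + toℕ p ≡ + (toℕ k ℕ.* N₁ C₂) ℤ.+ displacement p k ℤ.* + N₂ ℤ.+ + toℕ (X.suboffset p)
  position-in-S p k = begin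
    + toℕ p                                                    ≡⟨ cong +_ (Blocking.position X.subblocking p) ⟩
    + (X.subblock p ℕ.* N₂ ℕ.+ toℕ (X.suboffset p))            ≡⟨ shift-origin (X.subblock p) (toℕ k ℕ.* size C₂) N₂ _ ⟩
    + (toℕ k ℕ.* size C₂ ℕ.* N₂) ℤ.+ displacement p k ℤ.* + N₂ ℤ.+ + toℕ (X.suboffset p)
      ≡⟨ cong (λ z → + z ℤ.+ displacement p k ℤ.* + N₂ ℤ.+ + toℕ (X.suboffset p)) (ℕₚ.*-assoc (toℕ k) (size C₂) N₂) ⟩
    + (toℕ k ℕ.* N₁ C₂) ℤ.+ displacement p k ℤ.* + N₂ ℤ.+ + toℕ (X.suboffset p) ∎
    where open ≡-Reasoning

  ∈S⇒≡displacement : ∀ {p k k′} → p ∈S[ k , k′ ] → k′ ≡ displacement p k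
  ∈S⇒≡displacement {p} {k} (r , eq) = quotient-unique (+ (toℕ k ℕ.* N₁ C₂))
    (Finₚ.toℕ<n r) (Finₚ.toℕ<n (X.suboffset p)) (trans (sym eq) (position-in-S p k))

  ∈[_±w]? : ∀ j k → Dec (k ∈[ j ±w])
  ∈[ j ±w]? k = (fromℤ j - w O.≤? fromℤ k) ×-dec (fromℤ k O.≤? fromℤ j + w)

  -- The one field with an infinite range is `k′`, and `p` and `k` determine it; the search over the
  -- others is finite.
  G? : ∀ p q → Dec (G p q)
  G? p q = map′
    (λ (i , j , k , i′ , j′ , j∈ , k∈ , j′∈ , k′∈ , q∈ , eq) → record
      { i = i ; j = j ; j∈List₁ = j∈ ; k = k ; k∈ = k∈ ; i′ = i′ ; j′ = j′ ; j′∈List₂ = j′∈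
      ; k′ = displacement p k ; k′∈ = k′∈ ; p∈ = X.suboffset p , position-in-S p k ; q∈ = q∈ ; same = eq })
    (λ g → let open G g in i , j , k , i′ , j′ , j∈List₁ , k∈ , j′∈List₂
      , subst (_∈[ + toℕ j′ ±w]) (∈S⇒≡displacement {k = k} {k′} p∈) k′∈ , q∈ , same)
    (Finₚ.any? λ i → Finₚ.any? λ j → Finₚ.any? λ k → Finₚ.any? λ i′ → Finₚ.any? λ j′ →
      (j ∈₁? ListDecoder.Dec D₁ (toList (C′ i)))
      ×-dec ∈[ + toℕ j ±w]? (+ toℕ k)
      ×-dec (j′ ∈₂? ListDecoder.Dec D₂ (toList (C″ i i′)))
      ×-dec ∈[ + toℕ j′ ±w]? (displacement p k)
      ×-dec Finₚ.any? (λ r → q Finₚ.≟ combine i (combine i′ r))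
      ×-dec Productₚ.≡-dec _≟Γ_ (Productₚ.≡-dec Finₚ._≟_ Finₚ._≟_) (lookup S p) (lookup S′ q))
    where
    open DecMembership (Finₚ._≟_ {size C₁}) using () renaming (_∈?_ to _∈₁?_)
    open DecMembership (Finₚ._≟_ {size C₂}) using () renaming (_∈?_ to _∈₂?_)

  returns : ∃ Returns
  returns = largest-exists G?

  index₁ : ∀ p → proj₁ (proj₂ (lookup S p)) ≡ lookup (codeword C₁ (X.outer p)) (X.offset p)
  index₁ p = begin
    proj₁ (proj₂ (lookup S p))                        ≡⟨ cong (proj₁ ∘ proj₂) (Vecₚ.lookup-zip p m (I C₂ C₁)) ⟩
    proj₁ (lookup (I C₂ C₁) p)                        ≡⟨ cong proj₁ (Vecₚ.lookup-zip p (I₁ C₂ C₁) (I₂ C₂ C₁)) ⟩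
    lookup (I₁ C₂ C₁) p                               ≡⟨ cong (lookup (I₁ C₂ C₁)) (X.combine-offset p) ⟨
    lookup (I₁ C₂ C₁) (combine (X.outer p) (X.offset p))
      ≡⟨ Vecₚ.lookup-concat (Vec.tabulate (codeword C₁)) (X.outer p) (X.offset p) ⟩
    lookup (lookup (Vec.tabulate (codeword C₁)) (X.outer p)) (X.offset p)
      ≡⟨ cong (λ v → lookup v (X.offset p)) (Vecₚ.lookup∘tabulate (codeword C₁) (X.outer p)) ⟩
    lookup (codeword C₁ (X.outer p)) (X.offset p)     ∎
    where open ≡-Reasoning

  index₂ : ∀ p → proj₂ (proj₂ (lookup S p)) ≡ lookup (codeword C₂ (X.inner p)) (X.suboffset p)
  index₂ p = begin
    proj₂ (proj₂ (lookup S p))                        ≡⟨ cong (proj₂ ∘ proj₂) (Vecₚ.lookup-zip p m (I C₂ C₁)) ⟩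
    proj₂ (lookup (I C₂ C₁) p)                        ≡⟨ cong proj₂ (Vecₚ.lookup-zip p (I₁ C₂ C₁) (I₂ C₂ C₁)) ⟩
    lookup (I₂ C₂ C₁) p                               ≡⟨ cong (lookup (I₂ C₂ C₁)) (X.combine-offset p) ⟨
    lookup (I₂ C₂ C₁) (combine (X.outer p) (X.offset p))
      ≡⟨ Vecₚ.lookup-concat (Vec.replicate (size C₁) (allCodewords C₂)) (X.outer p) (X.offset p) ⟩
    lookup (lookup (Vec.replicate (size C₁) (allCodewords C₂)) (X.outer p)) (X.offset p)
      ≡⟨ cong (λ v → lookup v (X.offset p)) (Vecₚ.lookup-replicate (X.outer p) (allCodewords C₂)) ⟩
    lookup (allCodewords C₂) (X.offset p)             ≡⟨ cong (lookup (allCodewords C₂)) (X.combine-suboffset p) ⟨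
    lookup (allCodewords C₂) (combine (X.inner p) (X.suboffset p))
      ≡⟨ Vecₚ.lookup-concat (Vec.tabulate (codeword C₂)) (X.inner p) (X.suboffset p) ⟩
    lookup (lookup (Vec.tabulate (codeword C₂)) (X.inner p)) (X.suboffset p)
      ≡⟨ cong (λ v → lookup v (X.suboffset p)) (Vecₚ.lookup∘tabulate (codeword C₂) (X.inner p)) ⟩
    lookup (codeword C₂ (X.inner p)) (X.suboffset p)  ∎
    where open ≡-Reasoning

  same⇒same₁ : ∀ {p q} → Same S S′ p q → Same (codeword C₁ (X.outer p)) (C′ (Y.outer q)) (X.offset p) (Y.offset q)
  same⇒same₁ {p} {q} same = begin
    lookup (codeword C₁ (X.outer p)) (X.offset p)                         ≡⟨ index₁ p ⟨
    proj₁ (proj₂ (lookup S p))                                            ≡⟨ cong (proj₁ ∘ proj₂) same ⟩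
    proj₁ (proj₂ (lookup S′ q))                                           ≡⟨ cong (proj₁ ∘ proj₂ ∘ lookup S′) (Y.combine-offset q) ⟨
    proj₁ (proj₂ (lookup S′ (combine (Y.outer q) (Y.offset q))))          ≡⟨ Vecₚ.lookup∘tabulate _ (Y.offset q) ⟨
    lookup (C′ (Y.outer q)) (Y.offset q)                                  ∎
    where open ≡-Reasoning

  same⇒same₂ : ∀ {p q} → Same S S′ p q →
    Same (codeword C₂ (X.inner p)) (C″ (Y.outer q) (Y.inner q)) (X.suboffset p) (Y.suboffset q)
  same⇒same₂ {p} {q} same = begin
    lookup (codeword C₂ (X.inner p)) (X.suboffset p)                      ≡⟨ index₂ p ⟨
    proj₂ (proj₂ (lookup S p))                                            ≡⟨ cong (proj₂ ∘ proj₂) same ⟩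
    proj₂ (proj₂ (lookup S′ q))                                           ≡⟨ cong (proj₂ ∘ proj₂ ∘ lookup S′) (Y.combine-coordinates q) ⟨
    proj₂ (proj₂ (lookup S′ (combine (Y.outer q) (combine (Y.inner q) (Y.suboffset q)))))
      ≡⟨ Vecₚ.lookup∘tabulate _ (Y.suboffset q) ⟨
    lookup (C″ (Y.outer q) (Y.inner q)) (Y.suboffset q)                   ∎
    where open ≡-Reasoning

  module _ {M : List (Fin (|I| C₂ C₁) × Fin (b ℕ.* N₁ C₂))} (M↗ : NonCrossingMatching (Same S S′) M) where

    module Blocks = Prune (quotient-blocking (size C₁) (N₁ C₂)) (quotient-blocking b (N₁ C₂))
      (λ q → Finₚ.toℕ<n (Y.outer q)) refl (proj₂ M↗)

    module SubBlocks = Prune X.subblocking Y.subblocking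
      Y.subblock< (ℕₚ.*-assoc b (size C₂) N₂) (proj₂ M↗)

    -- The sub-block counted from is that of the witness p₂ of good₂, which need not lie
    -- in the block of p: k is the block of p₂, and k′ may leave the range of S(k).
    edge : ∀ {p q} → (p , q) ∈ M → Blocks.Good (toℕ (Y.outer q)) → SubBlocks.Good (Y.subblock q) → G p q
    edge {p} {q} e∈M good₁ good₂ = record
      { i        = Y.outer q
      ; j        = X.outer p₁
      ; j∈List₁  = Equivalence.from (ListDecoder.correct D₁ _ _) (Blocks.good⇒corrupts good₁ same₁)
      ; k        = X.outer p₂
      -- `B₁.near` is applied to the sub-block witness instead of `(p , q)`: equal sub-blocks of S′
      -- lie in equal blocks, so it too has its target in the block of `q`.
      ; k∈       = ∈±w⇒⊖∈ {s = 0} (B₁.near B₂.witness∈M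
                     (cong toℕ (proj₁ (Y.subblock-injective _ _ B₂.target≡))))
      ; i′       = Y.inner q
      ; j′       = X.inner p₂
      ; j′∈List₂ = Equivalence.from (ListDecoder.correct D₂ _ _) (SubBlocks.good⇒corrupts good₂ same₂)
      ; k′       = displacement p (X.outer p₂)
      ; k′∈      = ∈±w⇒⊖∈ {s = toℕ (X.outer p₂) ℕ.* size C₂} (B₂.near e∈M refl)
      ; p∈       = X.suboffset p , position-in-S p (X.outer p₂)
      ; q∈       = Y.suboffset q , sym (Y.combine-coordinates q)
      ; same     = All.lookup (proj₁ M↗) e∈M
      }
      where
      module B₁ = Blocks.Good good₁
      module B₂ = SubBlocks.Good good₂
      p₁ = proj₁ B₁.witness
      p₂ = proj₁ B₂.witness

      same₁ : ∀ {e} → e ∈ M → Blocks.source e ≡ Blocks.source B₁.witness → Blocks.target e ≡ toℕ (Y.outer q) →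
              Same (codeword C₁ (X.outer p₁)) (C′ (Y.outer q)) (X.offset (proj₁ e)) (Y.offset (proj₂ e))
      same₁ {e} e∈ s≡ t≡ = subst₂ (λ j i → Same (codeword C₁ j) (C′ i) (X.offset (proj₁ e)) (Y.offset (proj₂ e)))
        (Finₚ.toℕ-injective s≡) (Finₚ.toℕ-injective t≡) (same⇒same₁ (All.lookup (proj₁ M↗) e∈))

      same₂ : ∀ {e} → e ∈ M → SubBlocks.source e ≡ SubBlocks.source B₂.witness → SubBlocks.target e ≡ Y.subblock q →
              Same (codeword C₂ (X.inner p₂)) (C″ (Y.outer q) (Y.inner q)) (X.suboffset (proj₁ e)) (Y.suboffset (proj₂ e))
      same₂ {e} e∈ s≡ t≡ = subst₂
        (λ j ii′ → Same (codeword C₂ j) (C″ (proj₁ ii′) (proj₂ ii′)) (X.suboffset (proj₁ e)) (Y.suboffset (proj₂ e)))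
        (proj₂ (X.subblock-injective (proj₁ e) p₂ s≡))
        (uncurry (cong₂ _,_) (Y.subblock-injective (proj₂ e) q t≡))
        (same⇒same₂ (All.lookup (proj₁ M↗) e∈))

    -- Both predicates refer to `M`, not to what the inner filter leaves. The first pruning
    -- therefore cannot spoil the density of a sub-block, and the two losses simply add up.
    pruned : List (Fin (|I| C₂ C₁) × Fin (b ℕ.* N₁ C₂))
    pruned = filter (¬? ∘ SubBlocks.bad?) (filter (¬? ∘ Blocks.bad?) M)

    pruned↗ : NonCrossingMatching G pruned
    pruned↗ = All.tabulate (λ {e} e∈ →
          let e∈′ , ¬bad₂ = ∈ₚ.∈-filter⁻ (¬? ∘ SubBlocks.bad?) {xs = filter (¬? ∘ Blocks.bad?) M} e∈
              e∈M , ¬bad₁ = ∈ₚ.∈-filter⁻ (¬? ∘ Blocks.bad?) {xs = M} e∈′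
          in edge e∈M (Blocks.¬bad⇒good {e} ¬bad₁) (SubBlocks.¬bad⇒good {e} ¬bad₂))
      , AllPairsₚ.filter⁺ (¬? ∘ SubBlocks.bad?) (AllPairsₚ.filter⁺ (¬? ∘ Blocks.bad?) (proj₂ M↗))

    #bad : ℕ
    #bad = length (filter SubBlocks.bad? M) ℕ.+ length (filter Blocks.bad? M)

    length≤pruned+bad : length M ℕ.≤ length pruned ℕ.+ #bad
    length≤pruned+bad = begin
      length M                                                              ≡⟨ length-filter-¬ Blocks.bad? M ⟨
      length kept ℕ.+ length (filter Blocks.bad? M)
        ≡⟨ cong (ℕ._+ length (filter Blocks.bad? M)) (length-filter-¬ SubBlocks.bad? kept) ⟨
      length pruned ℕ.+ length (filter SubBlocks.bad? kept) ℕ.+ length (filter Blocks.bad? M)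
        ≤⟨ ℕₚ.+-monoˡ-≤ (length (filter Blocks.bad? M)) (ℕₚ.+-monoʳ-≤ (length pruned)
             (length-filter-filter SubBlocks.bad? (¬? ∘ Blocks.bad?) M)) ⟩
      length pruned ℕ.+ length (filter SubBlocks.bad? M) ℕ.+ length (filter Blocks.bad? M)
        ≡⟨ ℕₚ.+-assoc (length pruned) _ _ ⟩
      length pruned ℕ.+ #bad                                                ∎
      where
      open ℕₚ.≤-Reasoning
      kept = filter (¬? ∘ Blocks.bad?) M

    2*#bad≼ : ∀ {d} → |I| C₂ C₁ ℕ.+ b ℕ.* N₁ C₂ ℕ.≤ d ℕ.+ 2 ℕ.* length M → 2 ℕ.* #bad ≼ 23 ℕ.* d
    2*#bad≼ {d} le = ≼-monoʳ (ℕₚ.≤-trans (ℕₚ.≤-reflexive (arith d)) (ℕₚ.*-monoˡ-≤ d (ℕₚ.m≤m+n 12 11)))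
      (≼-* 2 (≼-+ (SubBlocks.bad≼3d {d} le) (Blocks.bad≼3d {d} le)))
      where
      arith : ∀ d → 2 ℕ.* (3 ℕ.* d ℕ.+ 3 ℕ.* d) ≡ 12 ℕ.* d
      arith = solve-∀

  forget : ∀ {M} → NonCrossingMatching G M → NonCrossingMatching (Same S S′) M
  forget = Product.map₁ (All.map G.same)

  -- The total number of symbols equals the number of operations plus `2 * length M`, and is at most
  -- `d + 2 * length M*`. So it suffices that the returned matching is at least as long as `pruned`.
  guarantee : ∀ {M} → Returns M → ∀ d → ED (toList S) (toList S′) d →
    fromℕ (length (operations S S′ M)) ≤ (1# + fromℕ 23 * ε) * fromℕ d
  guarantee {M} (M↗ , largest) d ed
    with os , steps , refl ← ED.attained ed
    with c , c≤ , al ← operations⇒alignment steps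
    with M* , M*↗ , eq ← alignment⇒matching al S S′ refl refl =
    approximation {length (operations S S′ M)} {d} {2 ℕ.* #bad M*↗} (ℕₚ.+-cancelʳ-≤ (2 ℕ.* length M) _ _ (begin
        length (operations S S′ M) ℕ.+ 2 ℕ.* length M
          ≡⟨ cong (ℕ._+ 2 ℕ.* length M) (length-ops (operations S S′ M)) ⟩
        #deletions (operations S S′ M) ℕ.+ #insertions (operations S S′ M) ℕ.+ 2 ℕ.* length M
          ≡⟨ arith₁ (#deletions (operations S S′ M)) (#insertions (operations S S′ M)) (length M) ⟩
        (#deletions (operations S S′ M) ℕ.+ length M) ℕ.+ (#insertions (operations S S′ M) ℕ.+ length M)
          ≡⟨ cong₂ ℕ._+_ (#deletions-operations S S′ (forget M↗)) (#insertions-operations S S′ (forget M↗)) ⟩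
        |I| C₂ C₁ ℕ.+ b ℕ.* N₁ C₂                            ≤⟨ optimal ⟩
        d ℕ.+ 2 ℕ.* length M*                                ≤⟨ ℕₚ.+-monoʳ-≤ d (ℕₚ.*-monoʳ-≤ 2 (length≤pruned+bad M*↗)) ⟩
        d ℕ.+ 2 ℕ.* (length (pruned M*↗) ℕ.+ #bad M*↗)
          ≤⟨ ℕₚ.+-monoʳ-≤ d (ℕₚ.*-monoʳ-≤ 2 (ℕₚ.+-monoˡ-≤ (#bad M*↗) (largest (pruned M*↗) (pruned↗ M*↗)))) ⟩
        d ℕ.+ 2 ℕ.* (length M ℕ.+ #bad M*↗)                  ≡⟨ arith₂ d (length M) (#bad M*↗) ⟩
        d ℕ.+ 2 ℕ.* #bad M*↗ ℕ.+ 2 ℕ.* length M              ∎))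
      (2*#bad≼ M*↗ {d} optimal)
    where
    open ℕₚ.≤-Reasoning
    optimal : |I| C₂ C₁ ℕ.+ b ℕ.* N₁ C₂ ℕ.≤ d ℕ.+ 2 ℕ.* length M*
    optimal = ℕₚ.≤-trans (ℕₚ.≤-reflexive eq) (ℕₚ.+-monoˡ-≤ (2 ℕ.* length M*) c≤)
    arith₁ : ∀ x y l → x ℕ.+ y ℕ.+ 2 ℕ.* l ≡ (x ℕ.+ l) ℕ.+ (y ℕ.+ l)
    arith₁ = solve-∀
    arith₂ : ∀ d l e → d ℕ.+ 2 ℕ.* (l ℕ.+ e) ≡ d ℕ.+ 2 ℕ.* e ℕ.+ 2 ℕ.* l
    arith₂ = solve-∀

theorem5p3 : ∀ {c ℓ₁ ℓ₂ a} (F : OrderedField c ℓ₁ ℓ₂) → let open OrderedField F in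
      (ε : Carrier) → 0# < ε → ε < fromℕ 121 ⁻¹ →
      ∀ {q₁ q₂ N₂ L₁ L₂ : ℕ} (C₂ : Code q₂ N₂) (C₁ : Code q₁ (N₁ C₂)) →
      (D₁ : ListDecoder F ε C₁ L₁) (D₂ : ListDecoder F ε C₂ L₂) →
      {Γ : Set a} → DecidableEquality Γ →
      (m : Vec Γ (|I| C₂ C₁)) (b : ℕ) (S′ : Vec (Γ × Fin q₁ × Fin q₂) (b ℕ.* N₁ C₂)) →
      let S = indexed C₂ C₁ m
          open Enhanced-ED-Approx F ε D₁ D₂ {b = b} S S′
      in ∃ Returns
         × (∀ M → Returns M →
              toList S ═⟨ operations S S′ M ⟩⇒ toList S′
              × (∀ d → ED (toList S) (toList S′) d →
                   fromℕ (length (operations S S′ M)) ≤ (1# + fromℕ 23 * ε) * fromℕ d))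
theorem5p3 F ε 0<ε ε<1/121 C₂ C₁ D₁ D₂ _≟_ m b S′ =
  returns , λ M M-returned → operations-correct S S′ (forget (proj₁ M-returned)) , guarantee M-returned
  where open Analysis F ε 0<ε ε<1/121 C₂ C₁ D₁ D₂ _≟_ m b S′
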